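{- Let $k_1,k_2,k_3\in\mathbb{Z}_{\ge0}$ and let $(P,Q,R)$ be a $(k_1,k_2,k_3)$-CGC triple associated with the non-labeled cluster $(a,b,c)$ such that $|b|>\max\{|a|,|c|\}$. Then there exists a unique Markov-monodromy decomposition $(X,Y,Z)$ of $(P,Q,R)$.
   Context: Fix $k_1,k_2,k_3\in\mathbb{Z}_{\ge0}$, indeterminates $x_1,x_2,x_3$. Mutations: $\mu_1(a,b,c)=(\frac{b^2+k_1bc+c^2}{a},b,c)$, $\mu_2(a,b,c)=(a,\frac{a^2+k_2ac+c^2}{b},c)$, $\mu_3(a,b,c)=(a,b,\frac{a^2+k_3ab+b^2}{c})$. Labeled clusters of $\mathcal{A}(k_1,k_2,k_3)$: triples obtained from $(x_1,x_2,x_3)$ by finitely many mutations; non-labeled clusters: permutations of labeled clusters; cluster variables: their entries; a cluster variable $y$ occurs in a unique position $i$ among labeled clusters, and its parity is $k_y:=k_i$. $|a|$ is the value of a Laurent polynomial $a$ at $x_1=x_2=x_3=1$. $\mathscr{M}=\frac{x_1^2+x_2^2+x_3^2+k_1x_2x_3+k_2x_1x_3+k_3x_1x_2}{x_1x_2x_3}$, $T=\begin{bmatrix}-1&0\\ \mathscr{M}&-1\end{bmatrix}$, and for a $2\times2$ matrix $P=(p_{ij})$, $S_P=\begin{bmatrix}\mathscr{M}p_{12}-\mathrm{tr}P&0\\(\mathscr{M}p_{12}-\mathrm{tr}P)\mathscr{M}&\mathscr{M}p_{12}-\mathrm{tr}P\end{bmatrix}$. A CGC matrix is $P\in SL(2,\mathbb{Z}[x_1^{\pm1},x_2^{\pm1},x_3^{\pm1}])$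 with $(1,2)$-entry $p_{12}$ a cluster variable and $\mathrm{tr}P=\mathscr{M}p_{12}-k_{p_{12}}$; a CGC triple is a triple $(P,Q,R)$ of CGC matrices with $Q=PR-S_Q$ and $(p_{12},q_{12},r_{12})$ a non-labeled cluster (associated cluster). A CMM matrix is $X\in SL(2,\mathbb{Z}[x_1^{\pm1},x_2^{\pm1},x_3^{\pm1}])$ with $(1,2)$-entry $x_{12}$ a cluster variable and $\mathrm{tr}X=-k_{x_{12}}$; a CMM triple is a triple $(X,Y,Z)$ of CMM matrices with $XYZ=T$ and $(x_{12},y_{12},z_{12})$ a non-labeled cluster. A Markov-monodromy decomposition of a CGC triple $(P,Q,R)$ associated with $(a,b,c)$ is a triple $(X,Y,Z)$ such that (1) $(X,Y,Z)$ is a CMM triple; (2) $P=-(YZ)^{ -1}$, $Q=-(XZ)^{ -1}$, $R=-(XY)^{ -1}$; (3) $\mathrm{tr}X=-k_a$, $\mathrm{tr}Y=-k_b$, $\mathrm{tr}Z=-k_c$. -}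

module Defs where

open import Data.Nat using (ℕ)
open import Data.Integer as ℤ using (ℤ; +_; -[1+_])
open import Data.Bool using (Bool; _∧_; if_then_else_)
open import Data.List using (List; []; _∷_; _++_; map; concatMap; foldr)
open import Data.Product using (_×_; _,_; Σ; ∃; ∃-syntax)
open import Data.Sum using (_⊎_)
open import Relation.Nullary.Decidable using (⌊_⌋)
open import Relation.Binary.PropositionalEquality using (_≡_)

-- The Laurent polynomial ring ℤ[x₁^{±1}, x₂^{±1}, x₃^{±1}]
-- represented as finite formal sums of terms c·x₁^e₁ x₂^e₂ x₃^e₃,
-- with equality "all coefficients agree" (a setoid).

record Mono : Set where
  constructor mono
  field
    e₁ e₂ e₃ : ℤ

sameMono : Mono → Mono → Bool
sameMono (mono a b c) (mono a' b' c') =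
  ⌊ a ℤ.≟ a' ⌋ ∧ ⌊ b ℤ.≟ b' ⌋ ∧ ⌊ c ℤ.≟ c' ⌋

monoMul : Mono → Mono → Mono
monoMul (mono a b c) (mono a' b' c') = mono (a ℤ.+ a') (b ℤ.+ b') (c ℤ.+ c')

Laurent : Set
Laurent = List (ℤ × Mono)

coeff : Laurent → Mono → ℤ
coeff [] m = + 0
coeff ((c , m') ∷ p) m = if sameMono m' m then c ℤ.+ coeff p m else coeff p m

infix 4 _≈_
_≈_ : Laurent → Laurent → Set
p ≈ q = ∀ m → coeff p m ≡ coeff q m

infixl 6 _+_ _-_
infixl 7 _*_

_+_ : Laurent → Laurent → Laurent
p + q = p ++ q

-_ : Laurent → Laurent
- p = map (λ { (c , m) → (ℤ.- c , m) }) p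

_-_ : Laurent → Laurent → Laurent
p - q = p + (- q)

_*_ : Laurent → Laurent → Laurent
p * q = concatMap (λ { (c , m) → map (λ { (d , n) → (c ℤ.* d , monoMul m n) }) q }) p

zeroL : Laurent
zeroL = []

cst : ℤ → Laurent
cst c = (c , mono (+ 0) (+ 0) (+ 0)) ∷ []

κ : ℕ → Laurent
κ k = cst (+ k)

x₁ x₂ x₃ : Laurent
x₁ = (+ 1 , mono (+ 1) (+ 0) (+ 0)) ∷ []
x₂ = (+ 1 , mono (+ 0) (+ 1) (+ 0)) ∷ []
x₃ = (+ 1 , mono (+ 0) (+ 0) (+ 1)) ∷ []

x123⁻¹ : Laurent
x123⁻¹ = (+ 1 , mono -[1+ 0 ] -[1+ 0 ] -[1+ 0 ]) ∷ []

-- |a| : value at x₁ = x₂ = x₃ = 1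
∣_∣ : Laurent → ℤ
∣ p ∣ = foldr (λ { (c , _) s → c ℤ.+ s }) (+ 0) p

module _ (k₁ k₂ k₃ : ℕ) where

  -- Labeled clusters, generated from (x₁,x₂,x₃) by mutations.  The
  -- quotient in a mutation is specified as an element a' with
  -- a · a' = numerator (unique up to ≈, the ring being a domain).
  data Labeled : Laurent → Laurent → Laurent → Set where
    base : ∀ {a b c} → a ≈ x₁ → b ≈ x₂ → c ≈ x₃ → Labeled a b c
    mut₁ : ∀ {a b c a'} → Labeled a b c →
           a * a' ≈ b * b + κ k₁ * b * c + c * c → Labeled a' b c
    mut₂ : ∀ {a b c b'} → Labeled a b c →
           b * b' ≈ a * a + κ k₂ * a * c + c * c → Labeled a b' c
    mut₃ : ∀ {a b c c'} → Labeled a b c →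
           c * c' ≈ a * a + κ k₃ * a * b + b * b → Labeled a b c'

  LabeledCluster : Laurent → Laurent → Laurent → Set
  LabeledCluster a b c = ∃[ a' ] ∃[ b' ] ∃[ c' ]
    (Labeled a' b' c' × a ≈ a' × b ≈ b' × c ≈ c')

  NonLabeledCluster : Laurent → Laurent → Laurent → Set
  NonLabeledCluster a b c =
    LabeledCluster a b c ⊎ LabeledCluster a c b ⊎ LabeledCluster b a c ⊎
    LabeledCluster b c a ⊎ LabeledCluster c a b ⊎ LabeledCluster c b a

  -- Parity y k : y is a cluster variable occurring in position i of a
  -- labeled cluster, and k = k_i  (i.e. k = k_y).
  data Parity (y : Laurent) : ℕ → Set where
    pos₁ : ∀ {a b c} → Labeled a b c → y ≈ a → Parity y k₁
    pos₂ : ∀ {a b c} → Labeled a b c → y ≈ b → Parity y k₂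
    pos₃ : ∀ {a b c} → Labeled a b c → y ≈ c → Parity y k₃

  ClusterVariable : Laurent → Set
  ClusterVariable y = ∃[ k ] Parity y k

  𝓜 : Laurent
  𝓜 = (x₁ * x₁ + x₂ * x₂ + x₃ * x₃ + κ k₁ * x₂ * x₃ + κ k₂ * x₁ * x₃ + κ k₃ * x₁ * x₂) * x123⁻¹

record Mat : Set where
  constructor mat
  field
    m₁₁ m₁₂ m₂₁ m₂₂ : Laurent
open Mat public

infix 4 _≈M_
_≈M_ : Mat → Mat → Set
A ≈M B = m₁₁ A ≈ m₁₁ B × m₁₂ A ≈ m₁₂ B × m₂₁ A ≈ m₂₁ B × m₂₂ A ≈ m₂₂ B

infixl 7 _·_
_·_ : Mat → Mat → Mat
A · B = mat (m₁₁ A * m₁₁ B + m₁₂ A * m₂₁ B) (m₁₁ A * m₁₂ B + m₁₂ A * m₂₂ B)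
            (m₂₁ A * m₁₁ B + m₂₂ A * m₂₁ B) (m₂₁ A * m₁₂ B + m₂₂ A * m₂₂ B)

infixl 6 _⊖_
_⊖_ : Mat → Mat → Mat
A ⊖ B = mat (m₁₁ A - m₁₁ B) (m₁₂ A - m₁₂ B) (m₂₁ A - m₂₁ B) (m₂₂ A - m₂₂ B)

negM : Mat → Mat
negM A = mat (- m₁₁ A) (- m₁₂ A) (- m₂₁ A) (- m₂₂ A)

tr : Mat → Laurent
tr A = m₁₁ A + m₂₂ A

det : Mat → Laurent
det A = m₁₁ A * m₂₂ A - m₁₂ A * m₂₁ A

-- adjugate; equals the inverse for matrices of determinant 1
inv : Mat → Mat
inv A = mat (m₂₂ A) (- m₁₂ A) (- m₂₁ A) (m₁₁ A)

InSL2 : Mat → Set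
InSL2 A = det A ≈ cst (+ 1)

module _ (k₁ k₂ k₃ : ℕ) where

  T : Mat
  T = mat (cst -[1+ 0 ]) zeroL (𝓜 k₁ k₂ k₃) (cst -[1+ 0 ])

  S : Mat → Mat
  S P = mat s zeroL (s * 𝓜 k₁ k₂ k₃) s
    where s = 𝓜 k₁ k₂ k₃ * m₁₂ P - tr P

  CGCMatrix : Mat → Set
  CGCMatrix P = InSL2 P ×
    ∃[ k ] (Parity k₁ k₂ k₃ (m₁₂ P) k × tr P ≈ 𝓜 k₁ k₂ k₃ * m₁₂ P - κ k)

  CGCTriple : Mat → Mat → Mat → Laurent → Laurent → Laurent → Set
  CGCTriple P Q R a b c =
    CGCMatrix P × CGCMatrix Q × CGCMatrix R ×
    Q ≈M P · R ⊖ S Q ×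
    m₁₂ P ≈ a × m₁₂ Q ≈ b × m₁₂ R ≈ c ×
    NonLabeledCluster k₁ k₂ k₃ a b c

  CMMMatrix : Mat → Set
  CMMMatrix X = InSL2 X ×
    ∃[ k ] (Parity k₁ k₂ k₃ (m₁₂ X) k × tr X ≈ - κ k)

  CMMTriple : Mat → Mat → Mat → Set
  CMMTriple X Y Z =
    CMMMatrix X × CMMMatrix Y × CMMMatrix Z ×
    X · Y · Z ≈M T ×
    NonLabeledCluster k₁ k₂ k₃ (m₁₂ X) (m₁₂ Y) (m₁₂ Z)

  TraceParity : Mat → Laurent → Set
  TraceParity X a = ∃[ k ] (Parity k₁ k₂ k₃ a k × tr X ≈ - κ k)

  MMDecomposition : Mat → Mat → Mat → Laurent → Laurent → Laurent →
                    Mat → Mat → Mat → Set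
  MMDecomposition P Q R a b c X Y Z =
    CMMTriple X Y Z ×
    P ≈M negM (inv (Y · Z)) × Q ≈M negM (inv (X · Z)) × R ≈M negM (inv (X · Y)) ×
    TraceParity X a × TraceParity Y b × TraceParity Z c

{-# OPTIONS --safe #-}

-- From X Y Z = T, Y Z = - P⁻¹ and X Y = - R⁻¹ one gets X = - T P, Z = - R T and Y = X⁻¹ T Z⁻¹, so there is
-- only one candidate.  Cayley–Hamilton for T Q turns Q = P R - S_Q into X Z = - Q⁻¹.
--
-- Let tr P = M a - k, tr Q = M b - l, tr R = M c - n, and let y be the (1,2)-entry of Y.  Comparing the
-- (1,2)-entries of X Y = T Z⁻¹, Y Z = X⁻¹ T and Y = X⁻¹ T Z⁻¹ yields b y = a² + l a c + c² and
-- M a b c = a² + b² + c² + k b c + l a c + n a b.  Hence y is the mutation of b as soon as l is the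
-- parity of the position that b occupies in the cluster.  Now every labeled cluster satisfies the
-- second equation with its own parities, and since mutations can be undone over the positive
-- rationals, ring homomorphisms to ℚ give the cluster arbitrary positive values.  Evaluating both
-- equations at (1,1,1) and (1,2,1) identifies l.

module Submission where

import Algebra.Consequences.Setoid
open import Algebra.Bundles using (CommutativeMonoid; CommutativeRing; Group; Monoid; RawRing)
open import Algebra.Morphism.Structures using (module RingMorphisms)
import Algebra.Properties.CommutativeSemigroup
import Algebra.Properties.Group
import Algebra.Properties.Monoid.Mult.TCOptimised
import Algebra.Properties.Ring
import Algebra.Properties.Semigroup
import Algebra.Solver.Ring
open import Algebra.Solver.Ring.AlmostCommutativeRing using (_-Raw-AlmostCommutative⟶_; fromCommutativeRing)
open import Data.Bool using (true; false; if_then_else_)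
open import Data.Integer as ℤ using (ℤ; +_; +[1+_]; -[1+_]; _<_; _⊔_)
import Data.Integer.Properties as ℤ
open import Data.List using ([]; _∷_; map)
open import Data.List.Properties using (++-assoc)
open import Data.List.Relation.Unary.All as All using (All; []; _∷_)
import Data.List.Relation.Unary.All.Properties as All
open import Data.Maybe using (Maybe; just; nothing)
open import Data.Nat as ℕ using (ℕ; zero; suc)
import Data.Nat.Properties as ℕ
open import Data.Product using (_×_; _,_; ∃-syntax; Σ; proj₁; proj₂)
open import Data.Rational as ℚ using (ℚ; 0ℚ; 1ℚ; NonNegative; Positive)
open import Data.Rational.Literals using (fromℤ)
import Data.Rational.Properties as ℚ
open import Data.Rational.Solver using (module +-*-Solver)
import Data.Rational.Unnormalised as ℚᵘ
import Data.Rational.Unnormalised.Properties as ℚᵘ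
open import Data.Sum as Sum using (inj₁; inj₂)
open import Function using (_∘_; _on_; const)
open import Level using (0ℓ)
open import Relation.Binary.Bundles using (Setoid)
import Relation.Binary.Construct.On as On
open import Relation.Binary.Core using (Rel)
open import Relation.Binary.PropositionalEquality as ≡ using (_≡_; module ≡-Reasoning)
import Relation.Binary.Reasoning.Setoid as SetoidReasoning
open import Relation.Binary.Structures using (IsEquivalence)
open import Relation.Nullary using (Reflects; no; ofʸ; ofⁿ; yes)

-- Integer multiples and integer coefficients

module IntegerMultiples {c ℓ} (M : CommutativeMonoid c ℓ) where

  open CommutativeMonoid M
  open Algebra.Properties.Monoid.Mult.TCOptimised monoid using (1+×; ×-homo-+) renaming (_×_ to infixr 8 _×′_)
  open Algebra.Properties.CommutativeSemigroup commutativeSemigroup using (interchange)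
  open SetoidReasoning setoid

  module Multiples (x x⁻¹ : Carrier) (x∙x⁻¹≈ε : x ∙ x⁻¹ ≈ ε) where

    multiple : ℤ → Carrier
    multiple (+ n) = n ×′ x
    multiple -[1+ n ] = suc n ×′ x⁻¹

    multiple-⊖ : ∀ m n → multiple (m ℤ.⊖ n) ≈ m ×′ x ∙ n ×′ x⁻¹
    multiple-⊖ zero    zero    = sym (identityˡ ε)
    multiple-⊖ zero    (suc n) = sym (identityˡ _)
    multiple-⊖ (suc m) zero    = sym (identityʳ _)
    multiple-⊖ (suc m) (suc n) = begin
      multiple (suc m ℤ.⊖ suc n)        ≡⟨ ≡.cong multiple (ℤ.[1+m]⊖[1+n]≡m⊖n m n) ⟩
      multiple (m ℤ.⊖ n)                ≈⟨ multiple-⊖ m n ⟩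
      m ×′ x ∙ n ×′ x⁻¹                 ≈⟨ identityˡ _ ⟨
      ε ∙ (m ×′ x ∙ n ×′ x⁻¹)           ≈⟨ ∙-congʳ x∙x⁻¹≈ε ⟨
      (x ∙ x⁻¹) ∙ (m ×′ x ∙ n ×′ x⁻¹)   ≈⟨ interchange x x⁻¹ (m ×′ x) (n ×′ x⁻¹) ⟩
      (x ∙ m ×′ x) ∙ (x⁻¹ ∙ n ×′ x⁻¹)   ≈⟨ ∙-cong (1+× m x) (1+× n x⁻¹) ⟨
      suc m ×′ x ∙ suc n ×′ x⁻¹         ∎

    multiple-+ : ∀ i j → multiple (i ℤ.+ j) ≈ multiple i ∙ multiple j
    multiple-+ (+ m)    (+ n)    = ×-homo-+ x m n
    multiple-+ (+ m)    -[1+ n ] = multiple-⊖ m (suc n)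
    multiple-+ -[1+ m ] (+ n)    = trans (multiple-⊖ n (suc m)) (comm _ _)
    multiple-+ -[1+ m ] -[1+ n ] = begin
      suc (suc (m ℕ.+ n)) ×′ x⁻¹   ≡⟨ ≡.cong (_×′ x⁻¹) (ℕ.+-suc (suc m) n) ⟨
      (suc m ℕ.+ suc n) ×′ x⁻¹     ≈⟨ ×-homo-+ x⁻¹ (suc m) (suc n) ⟩
      suc m ×′ x⁻¹ ∙ suc n ×′ x⁻¹  ∎

module IntegerCoefficients {c ℓ} (K : CommutativeRing c ℓ) where

  open CommutativeRing K
  open Algebra.Properties.Ring ring using (+-inverseˡ-unique; -‿distribˡ-*)
  open SetoidReasoning setoid

  open IntegerMultiples +-commutativeMonoid using (module Multiples)
  open Multiples 1# (- 1#) (-‿inverseʳ 1#) public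
    using () renaming (multiple to ι; multiple-+ to ι-+)

  ι-neg : ∀ i → ι (ℤ.- i) ≈ - ι i
  ι-neg i = +-inverseˡ-unique _ _ (begin
    ι (ℤ.- i) + ι i    ≈⟨ ι-+ (ℤ.- i) i ⟨
    ι (ℤ.- i ℤ.+ i)    ≡⟨ ≡.cong ι (ℤ.+-inverseˡ i) ⟩
    0#                 ∎)

  ι-*-pos : ∀ m j → ι (+ m ℤ.* j) ≈ ι (+ m) * ι j
  ι-*-pos zero    j = sym (zeroˡ (ι j))
  ι-*-pos (suc m) j = begin
    ι (+ suc m ℤ.* j)             ≡⟨ ≡.cong ι (ℤ.suc-* (+ m) j) ⟩
    ι (j ℤ.+ + m ℤ.* j)           ≈⟨ ι-+ j (+ m ℤ.* j) ⟩
    ι j + ι (+ m ℤ.* j)           ≈⟨ +-cong (sym (*-identityˡ (ι j))) (ι-*-pos m j) ⟩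
    1# * ι j + ι (+ m) * ι j      ≈⟨ distribʳ (ι j) 1# (ι (+ m)) ⟨
    (1# + ι (+ m)) * ι j          ≈⟨ *-congʳ (ι-+ (+ 1) (+ m)) ⟨
    ι (+ suc m) * ι j             ∎

  ι-* : ∀ i j → ι (i ℤ.* j) ≈ ι i * ι j
  ι-* (+ m)    j = ι-*-pos m j
  ι-* -[1+ m ] j = begin
    ι (-[1+ m ] ℤ.* j)            ≡⟨ ≡.cong ι (ℤ.neg-distribˡ-* (+ suc m) j) ⟨
    ι (ℤ.- (+ suc m ℤ.* j))       ≈⟨ ι-neg (+ suc m ℤ.* j) ⟩
    - ι (+ suc m ℤ.* j)           ≈⟨ -‿cong (ι-*-pos (suc m) j) ⟩
    - (ι (+ suc m) * ι j)         ≈⟨ -‿distribˡ-* (ι (+ suc m)) (ι j) ⟩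
    - ι (+ suc m) * ι j           ≈⟨ *-congʳ (ι-neg (+ suc m)) ⟨
    ι -[1+ m ] * ι j              ∎

  ι-homomorphism : ℤ.+-*-rawRing -Raw-AlmostCommutative⟶ fromCommutativeRing K
  ι-homomorphism = record
    { ⟦_⟧ = ι ; +-homo = ι-+ ; *-homo = ι-* ; -‿homo = ι-neg ; 0-homo = refl ; 1-homo = refl }

  ι-≟ : ∀ i j → Maybe (ι i ≈ ι j)
  ι-≟ i j with i ℤ.≟ j
  ... | yes ≡.refl = just refl
  ... | no _       = nothing

  open Algebra.Solver.Ring ℤ.+-*-rawRing (fromCommutativeRing K) ι-homomorphism ι-≟ public
    using (Polynomial; solve; _:+_; _:*_; :-_; _:-_; _:=_; con)

  polynomials : ℕ → RawRing 0ℓ 0ℓ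
  polynomials n = record
    { Carrier = Polynomial n ; _≈_ = _≡_ ; _+_ = _:+_ ; _*_ = _:*_ ; -_ = :-_ ; 0# = con (+ 0) ; 1# = con (+ 1) }

-- Factorizations of a group element into three factors

module TripleFactorization {c ℓ} (G : Group c ℓ) where

  open Group G
  open Algebra.Properties.Group G using (x≈z//y; y≈x\\z; \\-leftDividesˡ; //-rightDividesˡ; ∙-cancelˡ; ∙-cancelʳ)

  module _ {x y z t : Carrier} (xyz≈t : (x ∙ y) ∙ z ≈ t) where

    private
      x[yz]≈t : x ∙ (y ∙ z) ≈ t
      x[yz]≈t = trans (sym (assoc x y z)) xyz≈t

    x∙y≈t∙z⁻¹ : x ∙ y ≈ t ∙ z ⁻¹
    x∙y≈t∙z⁻¹ = x≈z//y (x ∙ y) z t xyz≈t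

    y∙z≈x⁻¹∙t : y ∙ z ≈ x ⁻¹ ∙ t
    y∙z≈x⁻¹∙t = y≈x\\z x (y ∙ z) t x[yz]≈t

    x≈t∙[y∙z]⁻¹ : x ≈ t ∙ (y ∙ z) ⁻¹
    x≈t∙[y∙z]⁻¹ = x≈z//y x (y ∙ z) t x[yz]≈t

    y≈x⁻¹∙[t∙z⁻¹] : y ≈ x ⁻¹ ∙ (t ∙ z ⁻¹)
    y≈x⁻¹∙[t∙z⁻¹] = y≈x\\z x y (t ∙ z ⁻¹) x∙y≈t∙z⁻¹

    z≈[x∙y]⁻¹∙t : z ≈ (x ∙ y) ⁻¹ ∙ t
    z≈[x∙y]⁻¹∙t = y≈x\\z (x ∙ y) z t xyz≈t

  module Factors (t p r : Carrier) where

    first middle last : Carrier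
    first  = t ∙ p
    last   = r ∙ t
    middle = first ⁻¹ ∙ (t ∙ last ⁻¹)

    first∙middle∙last≈t : (first ∙ middle) ∙ last ≈ t
    first∙middle∙last≈t = trans (∙-congʳ (\\-leftDividesˡ first (t ∙ last ⁻¹))) (//-rightDividesˡ last t)

    p≈[middle∙last]⁻¹ : p ≈ (middle ∙ last) ⁻¹
    p≈[middle∙last]⁻¹ = ∙-cancelˡ t _ _ (x≈t∙[y∙z]⁻¹ first∙middle∙last≈t)

    r≈[first∙middle]⁻¹ : r ≈ (first ∙ middle) ⁻¹
    r≈[first∙middle]⁻¹ = ∙-cancelʳ t _ _ (z≈[x∙y]⁻¹∙t first∙middle∙last≈t)

    module _ {x y z : Carrier} (xyz≈t : (x ∙ y) ∙ z ≈ t) (p≈ : p ≈ (y ∙ z) ⁻¹) (r≈ : r ≈ (x ∙ y) ⁻¹) where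

      first-unique : x ≈ first
      first-unique = trans (x≈t∙[y∙z]⁻¹ xyz≈t) (∙-congˡ (sym p≈))

      last-unique : z ≈ last
      last-unique = trans (z≈[x∙y]⁻¹∙t xyz≈t) (∙-congʳ (sym r≈))

      middle-unique : y ≈ middle
      middle-unique = trans (y≈x⁻¹∙[t∙z⁻¹] xyz≈t)
        (∙-cong (⁻¹-cong first-unique) (∙-congˡ (⁻¹-cong last-unique)))

-- Exchange relations and Markov equations

module Forms {c ℓ} (A : RawRing c ℓ) where

  open RawRing A

  exchangeForm : (k a c : Carrier) → Carrier
  exchangeForm k a c = a * a + k * a * c + c * c

  markovForm : (k l n a b c : Carrier) → Carrier
  markovForm k l n a b c = a * a + b * b + c * c + k * b * c + l * a * c + n * a * b

  record MarkovEquation (M k l n a b c : Carrier) : Set ℓ where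
    constructor satisfied
    field equation : M * (a * b * c) ≈ markovForm k l n a b c
  open MarkovEquation public

  record ExchangeRelation (k b b′ a c : Carrier) : Set ℓ where
    constructor related
    field relation : b * b′ ≈ exchangeForm k a c
  open ExchangeRelation public

module MarkovEquations {c ℓ} (K : CommutativeRing c ℓ) where

  open CommutativeRing K
  open IntegerCoefficients K
  open Forms rawRing public
  private module Poly {n : ℕ} = Forms (polynomials n)
  open SetoidReasoning setoid

  exchangeForm-cong : ∀ {k k′ a a′ c c′} → k ≈ k′ → a ≈ a′ → c ≈ c′ → exchangeForm k a c ≈ exchangeForm k′ a′ c′
  exchangeForm-cong k a c = +-cong (+-cong (*-cong a a) (*-cong (*-cong k a) c)) (*-cong c c)

  markovForm-cong : ∀ {k k′ l l′ n n′ a a′ b b′ c c′} →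
    k ≈ k′ → l ≈ l′ → n ≈ n′ → a ≈ a′ → b ≈ b′ → c ≈ c′ → markovForm k l n a b c ≈ markovForm k′ l′ n′ a′ b′ c′
  markovForm-cong k l n a b c = +-cong (+-cong (+-cong (+-cong (+-cong (*-cong a a) (*-cong b b)) (*-cong c c))
    (*-cong (*-cong k b) c)) (*-cong (*-cong l a) c)) (*-cong (*-cong n a) b)

  MarkovEquation-cong : ∀ {M k k′ l l′ n n′ a a′ b b′ c c′} →
    k ≈ k′ → l ≈ l′ → n ≈ n′ → a ≈ a′ → b ≈ b′ → c ≈ c′ →
    MarkovEquation M k l n a b c → MarkovEquation M k′ l′ n′ a′ b′ c′
  MarkovEquation-cong k l n a b c (satisfied abc) =
    satisfied (trans (*-congˡ (sym (*-cong (*-cong a b) c))) (trans abc (markovForm-cong k l n a b c)))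

  ExchangeRelation-cong : ∀ {k k′ x x′ y y′ a a′ c c′} →
    k ≈ k′ → x ≈ x′ → y ≈ y′ → a ≈ a′ → c ≈ c′ → ExchangeRelation k x y a c → ExchangeRelation k′ x′ y′ a′ c′
  ExchangeRelation-cong k x y a c (related xy) =
    related (trans (sym (*-cong x y)) (trans xy (exchangeForm-cong k a c)))

  ExchangeRelation-comm : ∀ {k x y a c} → ExchangeRelation k x y a c → ExchangeRelation k x y c a
  ExchangeRelation-comm {k} {a = a} {c} (related xy) = related (trans xy
    (solve 3 (λ k a c → Poly.exchangeForm k a c := Poly.exchangeForm k c a) refl k a c))

  MarkovEquation-swap₁₂ : ∀ {M k l n a b c} → MarkovEquation M k l n a b c → MarkovEquation M l k n b a c
  MarkovEquation-swap₁₂ {M} {k} {l} {n} {a} {b} {c} (satisfied abc) = satisfied (begin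
    M * (b * a * c)         ≈⟨ *-congˡ (*-congʳ (*-comm b a)) ⟩
    M * (a * b * c)         ≈⟨ abc ⟩
    markovForm k l n a b c  ≈⟨ solve 6 (λ k l n a b c →
      Poly.markovForm k l n a b c := Poly.markovForm l k n b a c) refl k l n a b c ⟩
    markovForm l k n b a c  ∎)

  MarkovEquation-swap₂₃ : ∀ {M k l n a b c} → MarkovEquation M k l n a b c → MarkovEquation M k n l a c b
  MarkovEquation-swap₂₃ {M} {k} {l} {n} {a} {b} {c} (satisfied abc) = satisfied (begin
    M * (a * c * b)         ≈⟨ *-congˡ (solve 3 (λ a b c → a :* c :* b := a :* b :* c) refl a b c) ⟩
    M * (a * b * c)         ≈⟨ abc ⟩
    markovForm k l n a b c  ≈⟨ solve 6 (λ k l n a b c →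
      Poly.markovForm k l n a b c := Poly.markovForm k n l a c b) refl k l n a b c ⟩
    markovForm k n l a c b  ∎)

  -- a and a′ are the two roots of the equation read as a monic quadratic in its first unknown; their
  -- product is exchangeForm k b c.
  vieta : ∀ {M k l n a a′ b c} → (∀ {x y} → a * x ≈ a * y → x ≈ y) →
    ExchangeRelation k a a′ b c → MarkovEquation M k l n a b c → MarkovEquation M k l n a′ b c
  vieta {M} {k} {l} {n} {a} {a′} {b} {c} cancel (related root-product) (satisfied abc) = satisfied (begin
    M * (a′ * b * c)                             ≈⟨ pull-out a′ ⟩
    a′ * (M * (b * c))                           ≈⟨ *-congˡ root-sum ⟩
    a′ * (a + a′ + l * c + n * b)                ≈⟨ solve 6 (λ a a′ b c l n →
      a′ :* (a :+ a′ :+ l :* c :+ n :* b) := a′ :* a′ :+ a :* a′ :+ l :* a′ :* c :+ n :* a′ :* b)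
      refl a a′ b c l n ⟩
    a′ * a′ + a * a′ + l * a′ * c + n * a′ * b   ≈⟨ +-congʳ (+-congʳ (+-congˡ root-product)) ⟩
    a′ * a′ + exchangeForm k b c + l * a′ * c + n * a′ * b  ≈⟨ collect a′ ⟨
    markovForm k l n a′ b c                      ∎)
    where
    pull-out : ∀ x → M * (x * b * c) ≈ x * (M * (b * c))
    pull-out x = solve 4 (λ M x b c → M :* (x :* b :* c) := x :* (M :* (b :* c))) refl M x b c

    collect : ∀ x → markovForm k l n x b c ≈ x * x + exchangeForm k b c + l * x * c + n * x * b
    collect x = solve 6 (λ k l n x b c → Poly.markovForm k l n x b c :=
      x :* x :+ Poly.exchangeForm k b c :+ l :* x :* c :+ n :* x :* b) refl k l n x b c

    root-sum : M * (b * c) ≈ a + a′ + l * c + n * b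
    root-sum = cancel (begin
      a * (M * (b * c))                            ≈⟨ pull-out a ⟨
      M * (a * b * c)                              ≈⟨ abc ⟩
      markovForm k l n a b c                       ≈⟨ collect a ⟩
      a * a + exchangeForm k b c + l * a * c + n * a * b  ≈⟨ +-congʳ (+-congʳ (+-congˡ root-product)) ⟨
      a * a + a * a′ + l * a * c + n * a * b       ≈⟨ solve 6 (λ a a′ b c l n →
        a :* a :+ a :* a′ :+ l :* a :* c :+ n :* a :* b := a :* (a :+ a′ :+ l :* c :+ n :* b))
        refl a a′ b c l n ⟩
      a * (a + a′ + l * c + n * b)                 ∎)

  -- The terms with coefficients k and n are linear in the middle unknown, so they cancel.
  middle-coefficient : ∀ k l n →
    (1# + 1#) * markovForm k l n 1# 1# 1# - markovForm k l n 1# (1# + 1#) 1# ≈ l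
  middle-coefficient = solve 3 (λ k l n → let 1ᴾ = con (+ 1) in
    (1ᴾ :+ 1ᴾ) :* Poly.markovForm k l n 1ᴾ 1ᴾ 1ᴾ :- Poly.markovForm k l n 1ᴾ (1ᴾ :+ 1ᴾ) 1ᴾ := l) refl

module FormHomomorphisms {c₁ ℓ₁ c₂ ℓ₂} (K : CommutativeRing c₁ ℓ₁) (L : CommutativeRing c₂ ℓ₂)
  {φ : CommutativeRing.Carrier K → CommutativeRing.Carrier L}
  (isRingHomomorphism : RingMorphisms.IsRingHomomorphism (CommutativeRing.rawRing K) (CommutativeRing.rawRing L) φ)
  where

  open CommutativeRing L
  open CommutativeRing K using () renaming (_+_ to _+ᴷ_; _*_ to _*ᴷ_)
  open RingMorphisms.IsRingHomomorphism isRingHomomorphism using (⟦⟧-cong; +-homo; *-homo)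
  private
    module K = MarkovEquations K
    module L = MarkovEquations L

  infixl 6 _⟨+⟩_
  infixl 7 _⟨*⟩_

  _⟨+⟩_ : ∀ {x y x′ y′} → φ x ≈ x′ → φ y ≈ y′ → φ (x +ᴷ y) ≈ x′ + y′
  p ⟨+⟩ q = trans (+-homo _ _) (+-cong p q)

  _⟨*⟩_ : ∀ {x y x′ y′} → φ x ≈ x′ → φ y ≈ y′ → φ (x *ᴷ y) ≈ x′ * y′
  p ⟨*⟩ q = trans (*-homo _ _) (*-cong p q)

  ExchangeRelation-homo : ∀ {k x y a c k′ x′ y′ a′ c′} →
    φ k ≈ k′ → φ x ≈ x′ → φ y ≈ y′ → φ a ≈ a′ → φ c ≈ c′ →
    K.ExchangeRelation k x y a c → L.ExchangeRelation k′ x′ y′ a′ c′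
  ExchangeRelation-homo k x y a c (K.related xy) = L.related (trans (sym (x ⟨*⟩ y))
    (trans (⟦⟧-cong xy) (a ⟨*⟩ a ⟨+⟩ k ⟨*⟩ a ⟨*⟩ c ⟨+⟩ c ⟨*⟩ c)))

  MarkovEquation-homo : ∀ {M k l n a b c k′ l′ n′ a′ b′ c′} →
    φ k ≈ k′ → φ l ≈ l′ → φ n ≈ n′ → φ a ≈ a′ → φ b ≈ b′ → φ c ≈ c′ →
    K.MarkovEquation M k l n a b c → L.MarkovEquation (φ M) k′ l′ n′ a′ b′ c′
  MarkovEquation-homo k l n a b c (K.satisfied abc) = L.satisfied (trans (sym (refl ⟨*⟩ (a ⟨*⟩ b ⟨*⟩ c)))
    (trans (⟦⟧-cong abc)
      (a ⟨*⟩ a ⟨+⟩ b ⟨*⟩ b ⟨+⟩ c ⟨*⟩ c ⟨+⟩ k ⟨*⟩ b ⟨*⟩ c ⟨+⟩ l ⟨*⟩ a ⟨*⟩ c ⟨+⟩ n ⟨*⟩ a ⟨*⟩ b)))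

-- Two-by-two matrices

record Matrix {a} (A : Set a) : Set a where
  constructor matrix
  field
    e₁₁ e₁₂ e₂₁ e₂₂ : A
open Matrix

module MatrixOperations {c ℓ} (A : RawRing c ℓ) where

  open RawRing A

  infixl 6 _⊕_ _⊖_
  infixl 7 _·_

  _⊕_ _⊖_ _·_ : Matrix Carrier → Matrix Carrier → Matrix Carrier
  X ⊕ Y = matrix (e₁₁ X + e₁₁ Y) (e₁₂ X + e₁₂ Y) (e₂₁ X + e₂₁ Y) (e₂₂ X + e₂₂ Y)
  X ⊖ Y = matrix (e₁₁ X + - e₁₁ Y) (e₁₂ X + - e₁₂ Y) (e₂₁ X + - e₂₁ Y) (e₂₂ X + - e₂₂ Y)
  X · Y = matrix (e₁₁ X * e₁₁ Y + e₁₂ X * e₂₁ Y) (e₁₁ X * e₁₂ Y + e₁₂ X * e₂₂ Y)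
                 (e₂₁ X * e₁₁ Y + e₂₂ X * e₂₁ Y) (e₂₁ X * e₁₂ Y + e₂₂ X * e₂₂ Y)

  neg adj : Matrix Carrier → Matrix Carrier
  neg X = matrix (- e₁₁ X) (- e₁₂ X) (- e₂₁ X) (- e₂₂ X)
  adj X = matrix (e₂₂ X) (- e₁₂ X) (- e₂₁ X) (e₁₁ X)

  I : Matrix Carrier
  I = matrix 1# 0# 0# 1#

  tr det : Matrix Carrier → Carrier
  tr X = e₁₁ X + e₂₂ X
  det X = e₁₁ X * e₂₂ X + - (e₁₂ X * e₂₁ X)

module SpecialLinear {c ℓ} (K : CommutativeRing c ℓ) where

  open CommutativeRing K
  open IntegerCoefficients K
  open Algebra.Properties.Ring ring using (-‿involutive; //-rightDividesˡ)
  open MatrixOperations rawRing public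
  private module Poly {n : ℕ} = MatrixOperations (polynomials n)

  infix 4 _≈₂_
  _≈₂_ : Rel (Matrix Carrier) ℓ
  X ≈₂ Y = e₁₁ X ≈ e₁₁ Y × e₁₂ X ≈ e₁₂ Y × e₂₁ X ≈ e₂₁ Y × e₂₂ X ≈ e₂₂ Y

  matrixMonoid : Monoid c ℓ
  matrixMonoid = record
    { Carrier = Matrix Carrier ; _≈_ = _≈₂_ ; _∙_ = _·_ ; ε = I
    ; isMonoid = record
      { isSemigroup = record
        { isMagma = record
          { isEquivalence = record
            { refl = refl , refl , refl , refl
            ; sym = λ (p , q , r , s) → sym p , sym q , sym r , sym s
            ; trans = λ (p , q , r , s) (p′ , q′ , r′ , s′) →
                trans p p′ , trans q q′ , trans r r′ , trans s s′ }
          ; ∙-cong = λ (p , q , r , s) (p′ , q′ , r′ , s′) →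
              dot p q p′ r′ , dot p q q′ s′ , dot r s p′ r′ , dot r s q′ s′ }
        ; assoc = λ (matrix a b c d) (matrix e f g h) (matrix i j k l) →
            dot-assoc a b e f g h i k , dot-assoc a b e f g h j l ,
            dot-assoc c d e f g h i k , dot-assoc c d e f g h j l }
      ; identity = (λ (matrix a b c d) → first-row a c , first-row b d , second-row a c , second-row b d)
                 , (λ (matrix a b c d) →
                     first-column a b , second-column a b , first-column c d , second-column c d) } }
    where
    dot : ∀ {a b c d a′ b′ c′ d′} → a ≈ a′ → b ≈ b′ → c ≈ c′ → d ≈ d′ → a * c + b * d ≈ a′ * c′ + b′ * d′
    dot p q r s = +-cong (*-cong p r) (*-cong q s)

    dot-assoc : ∀ a b e f g h i k →
      (a * e + b * g) * i + (a * f + b * h) * k ≈ a * (e * i + f * k) + b * (g * i + h * k)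
    dot-assoc = solve 8 (λ a b e f g h i k →
      (a :* e :+ b :* g) :* i :+ (a :* f :+ b :* h) :* k := a :* (e :* i :+ f :* k) :+ b :* (g :* i :+ h :* k)) refl

    first-row : ∀ a c → 1# * a + 0# * c ≈ a
    first-row = solve 2 (λ a c → con (+ 1) :* a :+ con (+ 0) :* c := a) refl

    second-row : ∀ a c → 0# * a + 1# * c ≈ c
    second-row = solve 2 (λ a c → con (+ 0) :* a :+ con (+ 1) :* c := c) refl

    first-column : ∀ a b → a * 1# + b * 0# ≈ a
    first-column = solve 2 (λ a b → a :* con (+ 1) :+ b :* con (+ 0) := a) refl

    second-column : ∀ a b → a * 0# + b * 1# ≈ b
    second-column = solve 2 (λ a b → a :* con (+ 0) :+ b :* con (+ 1) := b) refl

  private module M₂ = Monoid matrixMonoid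

  e₁₂-cong : ∀ {X Y} → X ≈₂ Y → e₁₂ X ≈ e₁₂ Y
  e₁₂-cong (_ , q , _ , _) = q

  neg-cong : ∀ {X Y} → X ≈₂ Y → neg X ≈₂ neg Y
  neg-cong (p , q , r , s) = -‿cong p , -‿cong q , -‿cong r , -‿cong s

  neg-involutive : ∀ X → neg (neg X) ≈₂ X
  neg-involutive (matrix a b c d) = -‿involutive a , -‿involutive b , -‿involutive c , -‿involutive d

  X≈-Y⇒-X≈Y : ∀ {X Y} → X ≈₂ neg Y → neg X ≈₂ Y
  X≈-Y⇒-X≈Y {Y = Y} X≈-Y = M₂.trans (neg-cong X≈-Y) (neg-involutive Y)

  -X≈Y⇒X≈-Y : ∀ {X Y} → neg X ≈₂ Y → X ≈₂ neg Y
  -X≈Y⇒X≈-Y {X} -X≈Y = M₂.trans (M₂.sym (neg-involutive X)) (neg-cong -X≈Y)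

  neg·neg : ∀ X Y → neg X · neg Y ≈₂ X · Y
  neg·neg (matrix a b c d) (matrix e f g h) = dot a b e g , dot a b f h , dot c d e g , dot c d f h
    where
    dot : ∀ a b c d → - a * - c + - b * - d ≈ a * c + b * d
    dot = solve 4 (λ a b c d → :- a :* :- c :+ :- b :* :- d := a :* c :+ b :* d) refl

  ⊖⇒⊕ : ∀ {X Y Z} → X ≈₂ Y ⊖ Z → Y ≈₂ X ⊕ Z
  ⊖⇒⊕ (p , q , r , s) = move p , move q , move r , move s
    where
    move : ∀ {x y z} → x ≈ y - z → y ≈ x + z
    move {y = y} {z} x≈y-z = trans (sym (//-rightDividesˡ z y)) (+-congʳ (sym x≈y-z))

  adj-cong : ∀ {X Y} → X ≈₂ Y → adj X ≈₂ adj Y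
  adj-cong (p , q , r , s) = s , -‿cong q , -‿cong r , p

  adj-involutive : ∀ X → adj (adj X) ≈₂ X
  adj-involutive (matrix a b c d) = refl , -‿involutive b , -‿involutive c , refl

  tr-cong : ∀ {X Y} → X ≈₂ Y → tr X ≈ tr Y
  tr-cong (p , _ , _ , s) = +-cong p s

  tr-comm : ∀ X Y → tr (X · Y) ≈ tr (Y · X)
  tr-comm (matrix a b c d) (matrix e f g h) = solve 8 (λ a b c d e f g h →
    let X = matrix a b c d ; Y = matrix e f g h in
    Poly.tr (X Poly.· Y) := Poly.tr (Y Poly.· X)) refl a b c d e f g h

  det-· : ∀ X Y → det (X · Y) ≈ det X * det Y
  det-· (matrix a b c d) (matrix e f g h) = solve 8 (λ a b c d e f g h →
    let X = matrix a b c d ; Y = matrix e f g h in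
    Poly.det (X Poly.· Y) := Poly.det X :* Poly.det Y) refl a b c d e f g h

  det-neg : ∀ X → det (neg X) ≈ det X
  det-neg (matrix a b c d) = solve 4 (λ a b c d →
    let X = matrix a b c d in Poly.det (Poly.neg X) := Poly.det X) refl a b c d

  det-adj : ∀ X → det (adj X) ≈ det X
  det-adj (matrix a b c d) = solve 4 (λ a b c d →
    let X = matrix a b c d in Poly.det (Poly.adj X) := Poly.det X) refl a b c d

  det-I : det I ≈ 1#
  det-I = solve 0 (Poly.det Poly.I := con (+ 1)) refl

  ·-adj : ∀ X → X · adj X ≈₂ matrix (det X) 0# 0# (det X)
  ·-adj (matrix a b c d) =
      solve 4 (λ a b c d → a :* d :+ b :* :- c := a :* d :- b :* c) refl a b c d
    , solve 2 (λ a b → a :* :- b :+ b :* a := con (+ 0)) refl a b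
    , solve 2 (λ c d → c :* d :+ d :* :- c := con (+ 0)) refl c d
    , solve 4 (λ a b c d → c :* :- b :+ d :* a := a :* d :- b :* c) refl a b c d

  record SL₂ : Set (c Level.⊔ ℓ) where
    constructor _because_
    field
      ⌊_⌋ : Matrix Carrier
      unimodular : det ⌊_⌋ ≈ 1#
  open SL₂ public

  negSL₂ : SL₂ → SL₂
  negSL₂ (X because detX) = neg X because trans (det-neg X) detX

  SL₂-group : Group (c Level.⊔ ℓ) ℓ
  SL₂-group = record
    { Carrier = SL₂ ; _≈_ = _≈₂_ on ⌊_⌋ ; _∙_ = _∙_ ; ε = I because det-I ; _⁻¹ = _⁻¹
    ; isGroup = record
      { isMonoid = record
        { isSemigroup = record
          { isMagma = record
            { isEquivalence = On.isEquivalence ⌊_⌋ M₂.isEquivalence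
            ; ∙-cong = λ {X} {X′} {Y} {Y′} → M₂.∙-cong {⌊ X ⌋} {⌊ X′ ⌋} {⌊ Y ⌋} {⌊ Y′ ⌋} }
          ; assoc = λ X Y Z → M₂.assoc ⌊ X ⌋ ⌊ Y ⌋ ⌊ Z ⌋ }
        ; identity = (λ X → M₂.identityˡ ⌊ X ⌋) , (λ X → M₂.identityʳ ⌊ X ⌋) }
      ; inverse = inverseˡ , inverseʳ
      ; ⁻¹-cong = λ {X} {Y} → adj-cong {⌊ X ⌋} {⌊ Y ⌋} } }
    where
    _∙_ : SL₂ → SL₂ → SL₂
    (X because detX) ∙ (Y because detY) =
      (X · Y) because trans (det-· X Y) (trans (*-cong detX detY) (*-identityˡ 1#))

    _⁻¹ : SL₂ → SL₂
    (X because detX) ⁻¹ = adj X because trans (det-adj X) detX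

    inverseʳ : ∀ X → ⌊ X ∙ (X ⁻¹) ⌋ ≈₂ I
    inverseʳ (X because detX) = M₂.trans (·-adj X) (detX , refl , refl , detX)

    inverseˡ : ∀ X → ⌊ (X ⁻¹) ∙ X ⌋ ≈₂ I
    inverseˡ X@(A because _) = M₂.trans (M₂.∙-congˡ (M₂.sym (adj-involutive A))) (inverseʳ (X ⁻¹))

-- Markov–monodromy factorizations

module MonodromyMatrices {c ℓ} (A : RawRing c ℓ) (M : RawRing.Carrier A) where

  open RawRing A
  open MatrixOperations A

  T : Matrix Carrier
  T = matrix (- 1#) 0# M (- 1#)

  S : Matrix Carrier → Matrix Carrier
  S X = matrix s 0# (s * M) s
    where
    s : Carrier
    s = M * e₁₂ X + - tr X

module Monodromy {c ℓ} (K : CommutativeRing c ℓ) (M : CommutativeRing.Carrier K) where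

  open CommutativeRing K
  open IntegerCoefficients K
  open MarkovEquations K
  open SpecialLinear K
  open MonodromyMatrices rawRing M public
  open Group SL₂-group using (_∙_; _⁻¹) renaming (_≈_ to _≈ₛ_)
  open TripleFactorization SL₂-group
  open Algebra.Properties.Group SL₂-group using (⁻¹-anti-homo-∙)
  open Algebra.Properties.Ring ring using (-‿involutive)
  open Algebra.Properties.Semigroup (Monoid.semigroup matrixMonoid) using (uv≈w⇒xu∙vy≈x∙wy)
  private
    module Poly {n : ℕ} where
      open MatrixOperations (polynomials n) public
      open MonodromyMatrices (polynomials n) public
      open Forms (polynomials n) public
    module M₂ = Monoid matrixMonoid

  det-T : det T ≈ 1#
  det-T = solve 1 (λ M → Poly.det (Poly.T M) := con (+ 1)) refl M

  T-SL₂ : SL₂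
  T-SL₂ = T because det-T

  e₁₂-T· : ∀ X → e₁₂ (T · X) ≈ - e₁₂ X
  e₁₂-T· (matrix a b c d) = solve 5 (λ M a b c d →
    e₁₂ (Poly.T M Poly.· matrix a b c d) := :- b) refl M a b c d

  e₁₂-·T : ∀ X → e₁₂ (X · T) ≈ - e₁₂ X
  e₁₂-·T (matrix a b c d) = solve 5 (λ M a b c d →
    e₁₂ (matrix a b c d Poly.· Poly.T M) := :- b) refl M a b c d

  tr-T·neg : ∀ X → tr (T · neg X) ≈ tr X - M * e₁₂ X
  tr-T·neg (matrix a b c d) = solve 5 (λ M a b c d → let X = matrix a b c d in
    Poly.tr (Poly.T M Poly.· Poly.neg X) := Poly.tr X :- M :* e₁₂ X) refl M a b c d

  tr-T·neg≈-k : ∀ X {k} → tr X ≈ M * e₁₂ X - k → tr (T · neg X) ≈ - k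
  tr-T·neg≈-k X {k} trX = begin
    tr (T · neg X)                   ≈⟨ tr-T·neg X ⟩
    tr X - M * e₁₂ X                 ≈⟨ +-congʳ trX ⟩
    M * e₁₂ X - k - M * e₁₂ X        ≈⟨ solve 2 (λ m k → m :- k :- m := :- k) refl (M * e₁₂ X) k ⟩
    - k                              ∎
    where open SetoidReasoning setoid

  -- S X = - s T⁻¹ for s = tr (T X), so for det X = 1 this is the Cayley–Hamilton theorem
  -- (T X)² - s (T X) = - 1 multiplied by X⁻¹ on the right.
  T·[X⊕S]·T : ∀ X → T · ((X ⊕ S X) · T) ≈₂ neg (adj X)
  T·[X⊕S]·T (matrix a b c d) =
      solve 5 (λ M a b c d → e₁₁ (lhs M a b c d) := e₁₁ (rhs a b c d)) refl M a b c d
    , solve 5 (λ M a b c d → e₁₂ (lhs M a b c d) := e₁₂ (rhs a b c d)) refl M a b c d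
    , solve 5 (λ M a b c d → e₂₁ (lhs M a b c d) := e₂₁ (rhs a b c d)) refl M a b c d
    , solve 5 (λ M a b c d → e₂₂ (lhs M a b c d) := e₂₂ (rhs a b c d)) refl M a b c d
    where
    lhs : (M a b c d : Polynomial 5) → Matrix (Polynomial 5)
    lhs M a b c d = let X = matrix a b c d in Poly.T M Poly.· ((X Poly.⊕ Poly.S M X) Poly.· Poly.T M)

    rhs : (a b c d : Polynomial 5) → Matrix (Polynomial 5)
    rhs a b c d = Poly.neg (Poly.adj (matrix a b c d))

  e₁₂[XZ]*e₁₂[Y] : ∀ X Y Z →
    e₁₂ (X · Z) * e₁₂ Y ≈ e₁₂ X * e₁₂ (Y · Z) + - tr Y * e₁₂ X * e₁₂ Z + e₁₂ (X · Y) * e₁₂ Z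
  e₁₂[XZ]*e₁₂[Y] (matrix x₁₁ x₁₂ x₂₁ x₂₂) (matrix y₁₁ y₁₂ y₂₁ y₂₂) (matrix z₁₁ z₁₂ z₂₁ z₂₂) =
    solve 12 (λ x₁₁ x₁₂ x₂₁ x₂₂ y₁₁ y₁₂ y₂₁ y₂₂ z₁₁ z₁₂ z₂₁ z₂₂ → let
        X = matrix x₁₁ x₁₂ x₂₁ x₂₂ ; Y = matrix y₁₁ y₁₂ y₂₁ y₂₂ ; Z = matrix z₁₁ z₁₂ z₂₁ z₂₂ in
      e₁₂ (X Poly.· Z) :* e₁₂ Y
        := e₁₂ X :* e₁₂ (Y Poly.· Z) :+ :- Poly.tr Y :* e₁₂ X :* e₁₂ Z :+ e₁₂ (X Poly.· Y) :* e₁₂ Z)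
      refl x₁₁ x₁₂ x₂₁ x₂₂ y₁₁ y₁₂ y₂₁ y₂₂ z₁₁ z₁₂ z₂₁ z₂₂

  e₁₂[XZ]+e₁₂[X⁻¹TZ⁻¹] : ∀ X Z →
    e₁₂ (X · Z) + e₁₂ (adj X · (T · adj Z)) ≈ M * e₁₂ X * e₁₂ Z + tr X * e₁₂ Z + tr Z * e₁₂ X
  e₁₂[XZ]+e₁₂[X⁻¹TZ⁻¹] (matrix x₁₁ x₁₂ x₂₁ x₂₂) (matrix z₁₁ z₁₂ z₂₁ z₂₂) =
    solve 9 (λ M x₁₁ x₁₂ x₂₁ x₂₂ z₁₁ z₁₂ z₂₁ z₂₂ → let
        X = matrix x₁₁ x₁₂ x₂₁ x₂₂ ; Z = matrix z₁₁ z₁₂ z₂₁ z₂₂ in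
      e₁₂ (X Poly.· Z) :+ e₁₂ (Poly.adj X Poly.· (Poly.T M Poly.· Poly.adj Z))
        := M :* e₁₂ X :* e₁₂ Z :+ Poly.tr X :* e₁₂ Z :+ Poly.tr Z :* e₁₂ X)
      refl M x₁₁ x₁₂ x₂₁ x₂₂ z₁₁ z₁₂ z₂₁ z₂₂

  module _ (X Y Z : SL₂) (XYZ≈T : (X ∙ Y) ∙ Z ≈ₛ T-SL₂) where

    private
      x y z q : Carrier
      x = e₁₂ ⌊ X ⌋
      y = e₁₂ ⌊ Y ⌋
      z = e₁₂ ⌊ Z ⌋
      q = e₁₂ ⌊ X ∙ Z ⌋

    open SetoidReasoning setoid

    e₁₂[XY]≈e₁₂[Z] : e₁₂ ⌊ X ∙ Y ⌋ ≈ z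
    e₁₂[XY]≈e₁₂[Z] = begin
      e₁₂ ⌊ X ∙ Y ⌋          ≈⟨ e₁₂-cong (x∙y≈t∙z⁻¹ {X} {Y} {Z} {T-SL₂} XYZ≈T) ⟩
      e₁₂ (T · adj ⌊ Z ⌋)    ≈⟨ e₁₂-T· (adj ⌊ Z ⌋) ⟩
      - - z                  ≈⟨ -‿involutive z ⟩
      z                      ∎

    e₁₂[YZ]≈e₁₂[X] : e₁₂ ⌊ Y ∙ Z ⌋ ≈ x
    e₁₂[YZ]≈e₁₂[X] = begin
      e₁₂ ⌊ Y ∙ Z ⌋          ≈⟨ e₁₂-cong (y∙z≈x⁻¹∙t {X} {Y} {Z} {T-SL₂} XYZ≈T) ⟩
      e₁₂ (adj ⌊ X ⌋ · T)    ≈⟨ e₁₂-·T (adj ⌊ X ⌋) ⟩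
      - - x                  ≈⟨ -‿involutive x ⟩
      x                      ∎

    exchange-product : ExchangeRelation (- tr ⌊ Y ⌋) q y x z
    exchange-product = related (trans (e₁₂[XZ]*e₁₂[Y] ⌊ X ⌋ ⌊ Y ⌋ ⌊ Z ⌋)
      (+-cong (+-congʳ (*-congˡ e₁₂[YZ]≈e₁₂[X])) (*-congʳ e₁₂[XY]≈e₁₂[Z])))

    exchange-sum : q + y ≈ M * x * z + tr ⌊ X ⌋ * z + tr ⌊ Z ⌋ * x
    exchange-sum = trans (+-congˡ (e₁₂-cong (y≈x⁻¹∙[t∙z⁻¹] {X} {Y} {Z} {T-SL₂} XYZ≈T)))
      (e₁₂[XZ]+e₁₂[X⁻¹TZ⁻¹] ⌊ X ⌋ ⌊ Z ⌋)

    markov-equation : MarkovEquation M (- tr ⌊ X ⌋) (- tr ⌊ Y ⌋) (- tr ⌊ Z ⌋) x q z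
    markov-equation = satisfied (begin
      M * (x * q * z)                                  ≈⟨ solve 6 (λ M trX trZ x q z →
        M :* (x :* q :* z) := q :* (M :* x :* z :+ trX :* z :+ trZ :* x) :+ (:- trX :* q :* z :+ :- trZ :* x :* q))
        refl M trX trZ x q z ⟩
      q * (M * x * z + trX * z + trZ * x) + rest       ≈⟨ +-congʳ (*-congˡ exchange-sum) ⟨
      q * (q + y) + rest                               ≈⟨ +-congʳ (distribˡ q q y) ⟩
      q * q + q * y + rest                             ≈⟨ +-congʳ (+-congˡ (relation exchange-product)) ⟩
      q * q + exchangeForm (- trY) x z + rest          ≈⟨ solve 6 (λ trX trY trZ x q z →
        q :* q :+ Poly.exchangeForm (:- trY) x z :+ (:- trX :* q :* z :+ :- trZ :* x :* q)
          := Poly.markovForm (:- trX) (:- trY) (:- trZ) x q z)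
        refl trX trY trZ x q z ⟩
      markovForm (- trX) (- trY) (- trZ) x q z         ∎)
      where
      trX trY trZ rest : Carrier
      trX = tr ⌊ X ⌋
      trY = tr ⌊ Y ⌋
      trZ = tr ⌊ Z ⌋
      rest = - trX * q * z + - trZ * x * q

  module Decomposition (P R : SL₂) where

    open Factors T-SL₂ (negSL₂ P) (negSL₂ R) public
      using () renaming (first to X; middle to Y; last to Z; first∙middle∙last≈t to XYZ≈T)
    open Factors T-SL₂ (negSL₂ P) (negSL₂ R)
      using (p≈[middle∙last]⁻¹; r≈[first∙middle]⁻¹; first-unique; middle-unique; last-unique)

    P≈-[YZ]⁻¹ : ⌊ P ⌋ ≈₂ neg ⌊ (Y ∙ Z) ⁻¹ ⌋
    P≈-[YZ]⁻¹ = -X≈Y⇒X≈-Y p≈[middle∙last]⁻¹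

    R≈-[XY]⁻¹ : ⌊ R ⌋ ≈₂ neg ⌊ (X ∙ Y) ⁻¹ ⌋
    R≈-[XY]⁻¹ = -X≈Y⇒X≈-Y r≈[first∙middle]⁻¹

    unique : ∀ X′ Y′ Z′ → (X′ ∙ Y′) ∙ Z′ ≈ₛ T-SL₂ →
      ⌊ P ⌋ ≈₂ neg ⌊ (Y′ ∙ Z′) ⁻¹ ⌋ → ⌊ R ⌋ ≈₂ neg ⌊ (X′ ∙ Y′) ⁻¹ ⌋ → X′ ≈ₛ X × Y′ ≈ₛ Y × Z′ ≈ₛ Z
    unique X′ Y′ Z′ X′Y′Z′≈T P≈ R≈ =
        first-unique {X′} {Y′} {Z′} X′Y′Z′≈T -P≈ -R≈
      , middle-unique {X′} {Y′} {Z′} X′Y′Z′≈T -P≈ -R≈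
      , last-unique {X′} {Y′} {Z′} X′Y′Z′≈T -P≈ -R≈
      where
      -P≈ : negSL₂ P ≈ₛ (Y′ ∙ Z′) ⁻¹
      -P≈ = X≈-Y⇒-X≈Y P≈
      -R≈ : negSL₂ R ≈ₛ (X′ ∙ Y′) ⁻¹
      -R≈ = X≈-Y⇒-X≈Y R≈

    e₁₂[X]≈e₁₂[P] : e₁₂ ⌊ X ⌋ ≈ e₁₂ ⌊ P ⌋
    e₁₂[X]≈e₁₂[P] = trans (e₁₂-T· (neg ⌊ P ⌋)) (-‿involutive (e₁₂ ⌊ P ⌋))

    e₁₂[Z]≈e₁₂[R] : e₁₂ ⌊ Z ⌋ ≈ e₁₂ ⌊ R ⌋
    e₁₂[Z]≈e₁₂[R] = trans (e₁₂-·T (neg ⌊ R ⌋)) (-‿involutive (e₁₂ ⌊ R ⌋))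

  module CGCTriple (P Q R : SL₂) (Q≈PR⊖S : ⌊ Q ⌋ ≈₂ ⌊ P ∙ R ⌋ ⊖ S ⌊ Q ⌋) where

    open Decomposition P R

    PR≈Q⊕S : ⌊ P ∙ R ⌋ ≈₂ ⌊ Q ⌋ ⊕ S ⌊ Q ⌋
    PR≈Q⊕S = ⊖⇒⊕ Q≈PR⊖S

    XZ≈-Q⁻¹ : ⌊ X ∙ Z ⌋ ≈₂ neg ⌊ Q ⁻¹ ⌋
    XZ≈-Q⁻¹ = M₂.trans
      (uv≈w⇒xu∙vy≈x∙wy (M₂.trans (neg·neg ⌊ P ⌋ ⌊ R ⌋) PR≈Q⊕S) T T)
      (T·[X⊕S]·T ⌊ Q ⌋)

    Q≈-[XZ]⁻¹ : ⌊ Q ⌋ ≈₂ neg ⌊ (X ∙ Z) ⁻¹ ⌋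
    Q≈-[XZ]⁻¹ = -X≈Y⇒X≈-Y (M₂.trans (M₂.sym (adj-involutive (neg ⌊ Q ⌋))) (adj-cong (M₂.sym XZ≈-Q⁻¹)))

    e₁₂[XZ]≈e₁₂[Q] : e₁₂ ⌊ X ∙ Z ⌋ ≈ e₁₂ ⌊ Q ⌋
    e₁₂[XZ]≈e₁₂[Q] = trans (e₁₂-cong XZ≈-Q⁻¹) (-‿involutive (e₁₂ ⌊ Q ⌋))

    module Traces {k l n : Carrier}
      (trP : tr ⌊ P ⌋ ≈ M * e₁₂ ⌊ P ⌋ - k)
      (trQ : tr ⌊ Q ⌋ ≈ M * e₁₂ ⌊ Q ⌋ - l)
      (trR : tr ⌊ R ⌋ ≈ M * e₁₂ ⌊ R ⌋ - n)
      where

      trX≈-k : tr ⌊ X ⌋ ≈ - k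
      trX≈-k = tr-T·neg≈-k ⌊ P ⌋ trP

      trY≈-l : tr ⌊ Y ⌋ ≈ - l
      trY≈-l = begin
        tr ⌊ X ⁻¹ ∙ (T-SL₂ ∙ Z ⁻¹) ⌋    ≈⟨ tr-comm ⌊ X ⁻¹ ⌋ ⌊ T-SL₂ ∙ Z ⁻¹ ⌋ ⟩
        tr ⌊ (T-SL₂ ∙ Z ⁻¹) ∙ X ⁻¹ ⌋    ≈⟨ tr-cong (M₂.assoc T ⌊ Z ⁻¹ ⌋ ⌊ X ⁻¹ ⌋) ⟩
        tr ⌊ T-SL₂ ∙ (Z ⁻¹ ∙ X ⁻¹) ⌋    ≈⟨ tr-cong (M₂.∙-congˡ (⁻¹-anti-homo-∙ X Z)) ⟨
        tr ⌊ T-SL₂ ∙ (X ∙ Z) ⁻¹ ⌋       ≈⟨ tr-cong (M₂.∙-congˡ (-X≈Y⇒X≈-Y (M₂.sym Q≈-[XZ]⁻¹))) ⟩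
        tr (T · neg ⌊ Q ⌋)              ≈⟨ tr-T·neg≈-k ⌊ Q ⌋ trQ ⟩
        - l                             ∎
        where open SetoidReasoning setoid

      trZ≈-n : tr ⌊ Z ⌋ ≈ - n
      trZ≈-n = trans (tr-comm (neg ⌊ R ⌋) T) (tr-T·neg≈-k ⌊ R ⌋ trR)

      private
        x≈-y⇒-x≈y : ∀ {x y} → x ≈ - y → - x ≈ y
        x≈-y⇒-x≈y {y = y} x≈-y = trans (-‿cong x≈-y) (-‿involutive y)

      exchange-QY : ExchangeRelation l (e₁₂ ⌊ Q ⌋) (e₁₂ ⌊ Y ⌋) (e₁₂ ⌊ X ⌋) (e₁₂ ⌊ Z ⌋)
      exchange-QY = ExchangeRelation-cong (x≈-y⇒-x≈y trY≈-l) e₁₂[XZ]≈e₁₂[Q] refl refl refl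
        (exchange-product X Y Z XYZ≈T)

      markov-XQZ : MarkovEquation M k l n (e₁₂ ⌊ X ⌋) (e₁₂ ⌊ Q ⌋) (e₁₂ ⌊ Z ⌋)
      markov-XQZ = MarkovEquation-cong
        (x≈-y⇒-x≈y trX≈-k) (x≈-y⇒-x≈y trY≈-l) (x≈-y⇒-x≈y trZ≈-n) refl e₁₂[XZ]≈e₁₂[Q] refl
        (markov-equation X Y Z XYZ≈T)

-- The Laurent polynomial ring

open import Defs
open ≡ using (refl; sym; trans; cong; cong₂; subst)

fromℤ-injective : ∀ {i j} → fromℤ i ≡ fromℤ j → i ≡ j
fromℤ-injective = proj₁ ∘ ℚ.mkℚ-injective

fromℤ-+ : ∀ i j → fromℤ (i ℤ.+ j) ≡ fromℤ i ℚ.+ fromℤ j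
fromℤ-+ i j = ℚ.toℚᵘ-injective (ℚᵘ.≃-sym (ℚᵘ.≃-trans (ℚ.toℚᵘ-homo-+ (fromℤ i) (fromℤ j))
  (ℚᵘ.*≡* (cong (ℤ._* + 1) (cong₂ ℤ._+_ (ℤ.*-identityʳ i) (ℤ.*-identityʳ j))))))

fromℤ-* : ∀ i j → fromℤ (i ℤ.* j) ≡ fromℤ i ℚ.* fromℤ j
fromℤ-* i j = ℚ.toℚᵘ-injective (ℚᵘ.≃-sym (ℚ.toℚᵘ-homo-* (fromℤ i) (fromℤ j)))

fromℤ-neg : ∀ i → fromℤ (ℤ.- i) ≡ ℚ.- fromℤ i
fromℤ-neg (+ 0)      = refl
fromℤ-neg +[1+ n ]   = refl
fromℤ-neg -[1+ n ]   = refl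

∑ : Laurent → (Mono → ℚ) → ℚ
∑ [] f = 0ℚ
∑ ((c , m) ∷ p) f = fromℤ c ℚ.* f m ℚ.+ ∑ p f

∑-ext : ∀ p {f g} → (∀ m → f m ≡ g m) → ∑ p f ≡ ∑ p g
∑-ext [] f≗g = refl
∑-ext ((c , m) ∷ p) f≗g = cong₂ (λ x s → fromℤ c ℚ.* x ℚ.+ s) (f≗g m) (∑-ext p f≗g)

_VanishesOn_ : (Mono → ℚ) → Laurent → Set
f VanishesOn p = All (λ (_ , m) → f m ≡ 0ℚ) p

∑-vanishing : ∀ {p f} → f VanishesOn p → ∑ p f ≡ 0ℚ
∑-vanishing [] = refl
∑-vanishing {(c , m) ∷ p} {f} (fm≡0 ∷ rest) = begin
  fromℤ c ℚ.* f m ℚ.+ ∑ p f   ≡⟨ cong₂ (λ x s → fromℤ c ℚ.* x ℚ.+ s) fm≡0 (∑-vanishing rest) ⟩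
  fromℤ c ℚ.* 0ℚ ℚ.+ 0ℚ       ≡⟨ ℚ.+-identityʳ _ ⟩
  fromℤ c ℚ.* 0ℚ              ≡⟨ ℚ.*-zeroʳ (fromℤ c) ⟩
  0ℚ                          ∎
  where open ≡-Reasoning

∑-+ : ∀ p q f → ∑ (p + q) f ≡ ∑ p f ℚ.+ ∑ q f
∑-+ [] q f = sym (ℚ.+-identityˡ _)
∑-+ ((c , m) ∷ p) q f =
  trans (cong (fromℤ c ℚ.* f m ℚ.+_) (∑-+ p q f)) (sym (ℚ.+-assoc (fromℤ c ℚ.* f m) (∑ p f) (∑ q f)))

∑-neg : ∀ p f → ∑ (- p) f ≡ ℚ.- ∑ p f
∑-neg [] f = refl
∑-neg ((c , m) ∷ p) f = begin
  fromℤ (ℤ.- c) ℚ.* f m ℚ.+ ∑ (- p) f        ≡⟨ cong₂ (λ x s → x ℚ.* f m ℚ.+ s) (fromℤ-neg c) (∑-neg p f) ⟩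
  (ℚ.- fromℤ c) ℚ.* f m ℚ.+ (ℚ.- ∑ p f)      ≡⟨ solve 3 (λ x y s → (:- x) :* y :+ (:- s) := :- (x :* y :+ s))
    refl (fromℤ c) (f m) (∑ p f) ⟩
  ℚ.- (fromℤ c ℚ.* f m ℚ.+ ∑ p f)            ∎
  where
  open ≡-Reasoning
  open +-*-Solver

∑-linear : ∀ p x f g → ∑ p (λ m → x ℚ.* f m ℚ.+ g m) ≡ x ℚ.* ∑ p f ℚ.+ ∑ p g
∑-linear [] x f g = sym (trans (ℚ.+-identityʳ _) (ℚ.*-zeroʳ x))
∑-linear ((c , m) ∷ p) x f g = begin
  fromℤ c ℚ.* (x ℚ.* f m ℚ.+ g m) ℚ.+ ∑ p (λ m → x ℚ.* f m ℚ.+ g m)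
    ≡⟨ cong (fromℤ c ℚ.* (x ℚ.* f m ℚ.+ g m) ℚ.+_) (∑-linear p x f g) ⟩
  fromℤ c ℚ.* (x ℚ.* f m ℚ.+ g m) ℚ.+ (x ℚ.* ∑ p f ℚ.+ ∑ p g)
    ≡⟨ solve 6 (λ c x y z s t → c :* (x :* y :+ z) :+ (x :* s :+ t) := x :* (c :* y :+ s) :+ (c :* z :+ t))
         refl (fromℤ c) x (f m) (g m) (∑ p f) (∑ p g) ⟩
  x ℚ.* ∑ ((c , m) ∷ p) f ℚ.+ ∑ ((c , m) ∷ p) g ∎
  where
  open ≡-Reasoning
  open +-*-Solver

∑-zero : ∀ p → ∑ p (const 0ℚ) ≡ 0ℚ
∑-zero p = ∑-vanishing (All.universal (λ _ → refl) p)

∑-scale : ∀ p x f → ∑ p (λ m → x ℚ.* f m) ≡ x ℚ.* ∑ p f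
∑-scale p x f = begin
  ∑ p (λ m → x ℚ.* f m)              ≡⟨ ∑-ext p (λ m → ℚ.+-identityʳ _) ⟨
  ∑ p (λ m → x ℚ.* f m ℚ.+ 0ℚ)       ≡⟨ ∑-linear p x f (const 0ℚ) ⟩
  x ℚ.* ∑ p f ℚ.+ ∑ p (const 0ℚ)     ≡⟨ cong (x ℚ.* ∑ p f ℚ.+_) (∑-zero p) ⟩
  x ℚ.* ∑ p f ℚ.+ 0ℚ                 ≡⟨ ℚ.+-identityʳ _ ⟩
  x ℚ.* ∑ p f                        ∎
  where open ≡-Reasoning

∑-swap : ∀ p q (f : Mono → Mono → ℚ) → ∑ p (λ m → ∑ q (f m)) ≡ ∑ q (λ n → ∑ p (λ m → f m n))
∑-swap [] q f = sym (∑-zero q)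
∑-swap ((c , m) ∷ p) q f =
  trans (cong (fromℤ c ℚ.* ∑ q (f m) ℚ.+_) (∑-swap p q f))
        (sym (∑-linear q (fromℤ c) (f m) (λ n → ∑ p (λ m → f m n))))

∑-* : ∀ p q f → ∑ (p * q) f ≡ ∑ p (λ m → ∑ q (f ∘ monoMul m))
∑-* [] q f = refl
∑-* ((c , m) ∷ p) q f =
  trans (∑-+ (map _ q) (p * q) f) (cong₂ ℚ._+_ (∑-map _ (λ _ _ → refl) q) (∑-* p q f))
  where
  -- h stands for the pattern-matching function in the definition of _*_, which has no name.
  ∑-map : ∀ h → (∀ d n → h (d , n) ≡ (c ℤ.* d , monoMul m n)) → ∀ q →
    ∑ (map h q) f ≡ fromℤ c ℚ.* ∑ q (f ∘ monoMul m)
  ∑-map h h≡ [] = sym (ℚ.*-zeroʳ (fromℤ c))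
  ∑-map h h≡ ((d , n) ∷ q) rewrite h≡ d n = begin
    fromℤ (c ℤ.* d) ℚ.* f (monoMul m n) ℚ.+ ∑ (map h q) f
      ≡⟨ cong₂ (λ x s → x ℚ.* f (monoMul m n) ℚ.+ s) (fromℤ-* c d) (∑-map h h≡ q) ⟩
    fromℤ c ℚ.* fromℤ d ℚ.* f (monoMul m n) ℚ.+ fromℤ c ℚ.* ∑ q (f ∘ monoMul m)
      ≡⟨ solve 4 (λ c d y s → c :* d :* y :+ c :* s := c :* (d :* y :+ s))
           refl (fromℤ c) (fromℤ d) (f (monoMul m n)) (∑ q (f ∘ monoMul m)) ⟩
    fromℤ c ℚ.* ∑ ((d , n) ∷ q) (f ∘ monoMul m) ∎
    where
    open ≡-Reasoning
    open +-*-Solver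

sameMono-reflects : ∀ m n → Reflects (m ≡ n) (sameMono m n)
sameMono-reflects (mono a b c) (mono a′ b′ c′) with a ℤ.≟ a′ | b ℤ.≟ b′ | c ℤ.≟ c′
... | yes refl | yes refl | yes refl = ofʸ refl
... | no a≢a′  | _        | _        = ofⁿ λ { refl → a≢a′ refl }
... | yes _    | no b≢b′  | _        = ofⁿ λ { refl → b≢b′ refl }
... | yes _    | yes _    | no c≢c′  = ofⁿ λ { refl → c≢c′ refl }

δ : Mono → Mono → ℚ
δ m n = if sameMono n m then 1ℚ else 0ℚ

∑-δ : ∀ p m → ∑ p (δ m) ≡ fromℤ (coeff p m)
∑-δ [] m = refl
∑-δ ((c , n) ∷ p) m with sameMono n m
... | true  = trans (cong₂ ℚ._+_ (ℚ.*-identityʳ (fromℤ c)) (∑-δ p m)) (sym (fromℤ-+ c (coeff p m)))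
... | false = trans (cong₂ ℚ._+_ (ℚ.*-zeroʳ (fromℤ c)) (∑-δ p m)) (ℚ.+-identityˡ _)

erase : Mono → (Mono → ℚ) → Mono → ℚ
erase m f n = if sameMono n m then 0ℚ else f n

eraseTerms : Laurent → (Mono → ℚ) → Mono → ℚ
eraseTerms [] f = f
eraseTerms ((_ , m) ∷ r) f = erase m (eraseTerms r f)

∑-erase : ∀ p m f → ∑ p f ≡ f m ℚ.* fromℤ (coeff p m) ℚ.+ ∑ p (erase m f)
∑-erase p m f = begin
  ∑ p f                                              ≡⟨ ∑-ext p split ⟩
  ∑ p (λ n → f m ℚ.* δ m n ℚ.+ erase m f n)          ≡⟨ ∑-linear p (f m) (δ m) (erase m f) ⟩
  f m ℚ.* ∑ p (δ m) ℚ.+ ∑ p (erase m f)              ≡⟨ cong (λ x → f m ℚ.* x ℚ.+ ∑ p (erase m f)) (∑-δ p m) ⟩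
  f m ℚ.* fromℤ (coeff p m) ℚ.+ ∑ p (erase m f)      ∎
  where
  open ≡-Reasoning
  split : ∀ n → f n ≡ f m ℚ.* δ m n ℚ.+ erase m f n
  split n with sameMono n m | sameMono-reflects n m
  ... | true  | ofʸ refl = sym (trans (ℚ.+-identityʳ _) (ℚ.*-identityʳ (f m)))
  ... | false | _        = sym (trans (cong (ℚ._+ f n) (ℚ.*-zeroʳ (f m))) (ℚ.+-identityˡ (f n)))

erase-self : ∀ m f → erase m f m ≡ 0ℚ
erase-self m f with sameMono m m | sameMono-reflects m m
... | true  | _       = refl
... | false | ofⁿ m≢m with () ← m≢m refl

erase-zero : ∀ m n f → f n ≡ 0ℚ → erase m f n ≡ 0ℚ
erase-zero m n f fn≡0 with sameMono n m
... | true  = refl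
... | false = fn≡0

eraseTerms-vanishes : ∀ r f → eraseTerms r f VanishesOn r
eraseTerms-vanishes [] f = []
eraseTerms-vanishes ((_ , m) ∷ r) f =
  erase-self m (eraseTerms r f) ∷
  All.map (λ {(_ , n)} → erase-zero m n (eraseTerms r f)) (eraseTerms-vanishes r f)

∑-eraseTerms : ∀ p q → p ≈ q → ∀ r f → ∑ p (eraseTerms r f) ≡ ∑ q (eraseTerms r f) → ∑ p f ≡ ∑ q f
∑-eraseTerms p q p≈q []            f eq = eq
∑-eraseTerms p q p≈q ((_ , m) ∷ r) f eq = ∑-eraseTerms p q p≈q r f (begin
  ∑ p g                                              ≡⟨ ∑-erase p m g ⟩
  g m ℚ.* fromℤ (coeff p m) ℚ.+ ∑ p (erase m g)      ≡⟨ cong₂ (λ c s → g m ℚ.* fromℤ c ℚ.+ s) (p≈q m) eq ⟩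
  g m ℚ.* fromℤ (coeff q m) ℚ.+ ∑ q (erase m g)      ≡⟨ ∑-erase q m g ⟨
  ∑ q g                                              ∎)
  where
  open ≡-Reasoning
  g : Mono → ℚ
  g = eraseTerms r f

infix 4 _≋_

-- Equivalent to _≈_, which unfolds to a function type from which Agda cannot infer p and q.
record _≋_ (p q : Laurent) : Set where
  constructor functionally
  field functional : ∀ f → ∑ p f ≡ ∑ q f
open _≋_

≈⇒≋ : ∀ {p q} → p ≈ q → p ≋ q
≈⇒≋ {p} {q} p≈q .functional f = ∑-eraseTerms p q p≈q (p + q) f
  (trans (∑-vanishing (All.++⁻ˡ p vanishes)) (sym (∑-vanishing (All.++⁻ʳ p vanishes))))
  where
  vanishes : eraseTerms (p + q) f VanishesOn (p + q)
  vanishes = eraseTerms-vanishes (p + q) f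

≋⇒≈ : ∀ {p q} → p ≋ q → p ≈ q
≋⇒≈ {p} {q} p≋q m = fromℤ-injective (begin
  fromℤ (coeff p m)  ≡⟨ ∑-δ p m ⟨
  ∑ p (δ m)          ≡⟨ functional p≋q (δ m) ⟩
  ∑ q (δ m)          ≡⟨ ∑-δ q m ⟩
  fromℤ (coeff q m)  ∎)
  where open ≡-Reasoning

one : Mono
one = mono (+ 0) (+ 0) (+ 0)

monoMul-comm : ∀ m n → monoMul m n ≡ monoMul n m
monoMul-comm (mono a b c) (mono a′ b′ c′) rewrite ℤ.+-comm a a′ | ℤ.+-comm b b′ | ℤ.+-comm c c′ = refl

monoMul-assoc : ∀ l m n → monoMul (monoMul l m) n ≡ monoMul l (monoMul m n)
monoMul-assoc (mono a b c) (mono a′ b′ c′) (mono a″ b″ c″)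
  rewrite ℤ.+-assoc a a′ a″ | ℤ.+-assoc b b′ b″ | ℤ.+-assoc c c′ c″ = refl

monoMul-identityˡ : ∀ m → monoMul one m ≡ m
monoMul-identityˡ (mono a b c) rewrite ℤ.+-identityˡ a | ℤ.+-identityˡ b | ℤ.+-identityˡ c = refl

∑-cst : ∀ i f → ∑ (cst i) f ≡ fromℤ i ℚ.* f one
∑-cst i f = ℚ.+-identityʳ _

≋-isEquivalence : IsEquivalence _≋_
≋-isEquivalence = record
  { refl = functionally λ f → refl
  ; sym = λ (functionally eq) → functionally λ f → sym (eq f)
  ; trans = λ (functionally eq) (functionally eq′) → functionally λ f → trans (eq f) (eq′ f) }

module ≋ = IsEquivalence ≋-isEquivalence

≋-setoid : Setoid 0ℓ 0ℓ
≋-setoid = record { isEquivalence = ≋-isEquivalence }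

open import Algebra.Definitions _≋_

+-cong : Congruent₂ _+_
+-cong {p} {p′} {q} {q′} p≋p′ q≋q′ .functional f = begin
  ∑ (p + q) f          ≡⟨ ∑-+ p q f ⟩
  ∑ p f ℚ.+ ∑ q f      ≡⟨ cong₂ ℚ._+_ (functional p≋p′ f) (functional q≋q′ f) ⟩
  ∑ p′ f ℚ.+ ∑ q′ f    ≡⟨ ∑-+ p′ q′ f ⟨
  ∑ (p′ + q′) f        ∎
  where open ≡-Reasoning

+-assoc : Associative _+_
+-assoc p q r .functional f = cong (λ s → ∑ s f) (++-assoc p q r)

+-comm : Commutative _+_
+-comm p q .functional f = begin
  ∑ (p + q) f          ≡⟨ ∑-+ p q f ⟩
  ∑ p f ℚ.+ ∑ q f      ≡⟨ ℚ.+-comm (∑ p f) (∑ q f) ⟩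
  ∑ q f ℚ.+ ∑ p f      ≡⟨ ∑-+ q p f ⟨
  ∑ (q + p) f          ∎
  where open ≡-Reasoning

-‿cong : Congruent₁ (-_)
-‿cong {p} {q} p≋q .functional f = begin
  ∑ (- p) f            ≡⟨ ∑-neg p f ⟩
  ℚ.- ∑ p f            ≡⟨ cong ℚ.-_ (functional p≋q f) ⟩
  ℚ.- ∑ q f            ≡⟨ ∑-neg q f ⟨
  ∑ (- q) f            ∎
  where open ≡-Reasoning

-‿inverseʳ : RightInverse zeroL (-_) _+_
-‿inverseʳ p .functional f = begin
  ∑ (p - p) f          ≡⟨ ∑-+ p (- p) f ⟩
  ∑ p f ℚ.+ ∑ (- p) f  ≡⟨ cong (∑ p f ℚ.+_) (∑-neg p f) ⟩
  ∑ p f ℚ.- ∑ p f      ≡⟨ ℚ.+-inverseʳ (∑ p f) ⟩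
  0ℚ                   ∎
  where open ≡-Reasoning

*-cong : Congruent₂ _*_
*-cong {p} {p′} {q} {q′} p≋p′ q≋q′ .functional f = begin
  ∑ (p * q) f                            ≡⟨ ∑-* p q f ⟩
  ∑ p (λ m → ∑ q (f ∘ monoMul m))        ≡⟨ ∑-ext p (λ m → functional q≋q′ (f ∘ monoMul m)) ⟩
  ∑ p (λ m → ∑ q′ (f ∘ monoMul m))       ≡⟨ functional p≋p′ _ ⟩
  ∑ p′ (λ m → ∑ q′ (f ∘ monoMul m))      ≡⟨ ∑-* p′ q′ f ⟨
  ∑ (p′ * q′) f                          ∎
  where open ≡-Reasoning

*-assoc : Associative _*_
*-assoc p q r .functional f = begin
  ∑ ((p * q) * r) f                                                     ≡⟨ ∑-* (p * q) r f ⟩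
  ∑ (p * q) (λ l → ∑ r (f ∘ monoMul l))                                 ≡⟨ ∑-* p q _ ⟩
  ∑ p (λ m → ∑ q (λ n → ∑ r (λ l → f (monoMul (monoMul m n) l))))
    ≡⟨ ∑-ext p (λ m → ∑-ext q (λ n → ∑-ext r (λ l → cong f (monoMul-assoc m n l)))) ⟩
  ∑ p (λ m → ∑ q (λ n → ∑ r (λ l → f (monoMul m (monoMul n l)))))       ≡⟨ ∑-ext p (λ m → ∑-* q r _) ⟨
  ∑ p (λ m → ∑ (q * r) (f ∘ monoMul m))                                 ≡⟨ ∑-* p (q * r) f ⟨
  ∑ (p * (q * r)) f                                                     ∎
  where open ≡-Reasoning

*-comm : Commutative _*_
*-comm p q .functional f = begin
  ∑ (p * q) f                                 ≡⟨ ∑-* p q f ⟩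
  ∑ p (λ m → ∑ q (λ n → f (monoMul m n)))     ≡⟨ ∑-swap p q _ ⟩
  ∑ q (λ n → ∑ p (λ m → f (monoMul m n)))     ≡⟨ ∑-ext q (λ n → ∑-ext p (λ m → cong f (monoMul-comm m n))) ⟩
  ∑ q (λ n → ∑ p (λ m → f (monoMul n m)))     ≡⟨ ∑-* q p f ⟨
  ∑ (q * p) f                                 ∎
  where open ≡-Reasoning

*-identityˡ : LeftIdentity (cst (+ 1)) _*_
*-identityˡ p .functional f = begin
  ∑ (cst (+ 1) * p) f                        ≡⟨ ∑-* (cst (+ 1)) p f ⟩
  ∑ (cst (+ 1)) (λ m → ∑ p (f ∘ monoMul m))  ≡⟨ ∑-cst (+ 1) (λ m → ∑ p (f ∘ monoMul m)) ⟩
  1ℚ ℚ.* ∑ p (f ∘ monoMul one)               ≡⟨ ℚ.*-identityˡ _ ⟩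
  ∑ p (f ∘ monoMul one)                      ≡⟨ ∑-ext p (λ m → cong f (monoMul-identityˡ m)) ⟩
  ∑ p f                                      ∎
  where open ≡-Reasoning

*-distribʳ-+ : _*_ DistributesOverʳ _+_
*-distribʳ-+ p q r .functional f = begin
  ∑ ((q + r) * p) f                                                   ≡⟨ ∑-* (q + r) p f ⟩
  ∑ (q + r) (λ m → ∑ p (f ∘ monoMul m))                               ≡⟨ ∑-+ q r _ ⟩
  ∑ q (λ m → ∑ p (f ∘ monoMul m)) ℚ.+ ∑ r (λ m → ∑ p (f ∘ monoMul m)) ≡⟨ cong₂ ℚ._+_ (∑-* q p f) (∑-* r p f) ⟨
  ∑ (q * p) f ℚ.+ ∑ (r * p) f                                         ≡⟨ ∑-+ (q * p) (r * p) f ⟨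
  ∑ (q * p + r * p) f                                                 ∎
  where open ≡-Reasoning

laurentRing : CommutativeRing 0ℓ 0ℓ
laurentRing = record
  { Carrier = Laurent ; _≈_ = _≋_ ; _+_ = _+_ ; _*_ = _*_ ; -_ = -_ ; 0# = zeroL ; 1# = cst (+ 1)
  ; isCommutativeRing = record
    { isRing = record
      { +-isAbelianGroup = record
        { isGroup = record
          { isMonoid = record
            { isSemigroup = record
              { isMagma = record { isEquivalence = ≋-isEquivalence ; ∙-cong = +-cong }
              ; assoc = +-assoc }
            ; identity = comm∧idˡ⇒id +-comm (λ p → ≋.refl) }
          ; inverse = comm∧invʳ⇒inv +-comm -‿inverseʳ
          ; ⁻¹-cong = -‿cong }
        ; comm = +-comm }
      ; *-cong = *-cong
      ; *-assoc = *-assoc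
      ; *-identity = comm∧idˡ⇒id *-comm *-identityˡ
      ; distrib = comm∧distrʳ⇒distr +-cong *-comm *-distribʳ-+ }
    ; *-comm = *-comm } }
  where open Algebra.Consequences.Setoid ≋-setoid

-- Values of clusters under ring homomorphisms to ℚ

open RingMorphisms (CommutativeRing.rawRing laurentRing) (CommutativeRing.rawRing ℚ.+-*-commutativeRing)
  using (IsRingHomomorphism)

record Character : Set where
  field
    χ : Mono → ℚ
    χ-one : χ one ≡ 1ℚ
    χ-monoMul : ∀ m n → χ (monoMul m n) ≡ χ m ℚ.* χ n

  ev : Laurent → ℚ
  ev p = ∑ p χ

  ev-cong : ∀ {p q} → p ≋ q → ev p ≡ ev q
  ev-cong p≋q = _≋_.functional p≋q χ

  ev-cst : ∀ i → ev (cst i) ≡ fromℤ i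
  ev-cst i = begin
    ev (cst i)           ≡⟨ ∑-cst i χ ⟩
    fromℤ i ℚ.* χ one    ≡⟨ cong (fromℤ i ℚ.*_) χ-one ⟩
    fromℤ i ℚ.* 1ℚ       ≡⟨ ℚ.*-identityʳ (fromℤ i) ⟩
    fromℤ i              ∎
    where open ≡-Reasoning

  ev-* : ∀ p q → ev (p * q) ≡ ev p ℚ.* ev q
  ev-* p q = begin
    ∑ (p * q) χ                              ≡⟨ ∑-* p q χ ⟩
    ∑ p (λ m → ∑ q (λ n → χ (monoMul m n)))  ≡⟨ ∑-ext p (λ m → ∑-ext q (χ-monoMul m)) ⟩
    ∑ p (λ m → ∑ q (λ n → χ m ℚ.* χ n))      ≡⟨ ∑-ext p (λ m → trans (∑-scale q (χ m) χ) (ℚ.*-comm (χ m) (ev q))) ⟩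
    ∑ p (λ m → ev q ℚ.* χ m)                 ≡⟨ ∑-scale p (ev q) χ ⟩
    ev q ℚ.* ev p                            ≡⟨ ℚ.*-comm (ev q) (ev p) ⟩
    ev p ℚ.* ev q                            ∎
    where open ≡-Reasoning

  ev-isRingHomomorphism : IsRingHomomorphism ev
  ev-isRingHomomorphism = record
    { isSemiringHomomorphism = record
      { isNearSemiringHomomorphism = record
        { +-isMonoidHomomorphism = record
          { isMagmaHomomorphism = record
            { isRelHomomorphism = record { cong = ev-cong }
            ; homo = λ p q → ∑-+ p q χ }
          ; ε-homo = refl }
        ; *-homo = ev-* }
      ; 1#-homo = ev-cst (+ 1) }
    ; -‿homo = λ p → ∑-neg p χ }

module ℚ-Forms = MarkovEquations ℚ.+-*-commutativeRing
module Laurent-Forms = MarkovEquations laurentRing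

natural : ℕ → ℚ
natural k = fromℤ (+ k)

exchangeForm-positive : ∀ k v w .{{_ : Positive v}} .{{_ : Positive w}} →
  Positive (ℚ-Forms.exchangeForm (natural k) v w)
exchangeForm-positive k v w =
  ℚ.nonNeg+pos⇒pos (v ℚ.* v ℚ.+ natural k ℚ.* v ℚ.* w) {{sum≥0}} (w ℚ.* w) {{ℚ.pos*pos⇒pos w w}}
  where
  instance
    v≥0 : NonNegative v
    v≥0 = ℚ.pos⇒nonNeg v
    w≥0 : NonNegative w
    w≥0 = ℚ.pos⇒nonNeg w
    kv≥0 : NonNegative (natural k ℚ.* v)
    kv≥0 = ℚ.nonNeg*nonNeg⇒nonNeg (natural k) v
  sum≥0 : NonNegative (v ℚ.* v ℚ.+ natural k ℚ.* v ℚ.* w)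
  sum≥0 = ℚ.nonNeg+nonNeg⇒nonNeg (v ℚ.* v) {{ℚ.nonNeg*nonNeg⇒nonNeg v v}}
    (natural k ℚ.* v ℚ.* w) {{ℚ.nonNeg*nonNeg⇒nonNeg (natural k ℚ.* v) w}}

*-cancelˡ-pos : ∀ u .{{_ : Positive u}} {x y} → u ℚ.* x ≡ u ℚ.* y → x ≡ y
*-cancelˡ-pos u eq =
  ℚ.≤-antisym (ℚ.*-cancelˡ-≤-pos u (ℚ.≤-reflexive eq)) (ℚ.*-cancelˡ-≤-pos u (ℚ.≤-reflexive (sym eq)))

÷-*-cancel : ∀ p q .{{_ : ℚ.NonZero q}} → (p ℚ.÷ q) ℚ.* q ≡ p
÷-*-cancel p q = begin
  p ℚ.* ℚ.1/ q ℚ.* q      ≡⟨ ℚ.*-assoc p (ℚ.1/ q) q ⟩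
  p ℚ.* (ℚ.1/ q ℚ.* q)    ≡⟨ cong (p ℚ.*_) (ℚ.*-inverseˡ q) ⟩
  p ℚ.* 1ℚ                ≡⟨ ℚ.*-identityʳ p ⟩
  p                       ∎
  where open ≡-Reasoning

module Realizations (M : Laurent) where

  record Realization (k l n : ℕ) (a b c : Laurent) (u v w : ℚ) : Set where
    field character : Character
    open Character character public
    field
      ev-a : ev a ≡ u
      ev-b : ev b ≡ v
      ev-c : ev c ≡ w
      markov : ℚ-Forms.MarkovEquation (ev M) (natural k) (natural l) (natural n) u v w

  FreelyRealizable : (k l n : ℕ) (a b c : Laurent) → Set
  FreelyRealizable k l n a b c =
    ∀ u v w .{{_ : Positive u}} .{{_ : Positive v}} .{{_ : Positive w}} → Realization k l n a b c u v w

  realizable-resp : ∀ {k l n a b c a′ b′ c′} → a ≋ a′ → b ≋ b′ → c ≋ c′ →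
    FreelyRealizable k l n a b c → FreelyRealizable k l n a′ b′ c′
  realizable-resp a≋a′ b≋b′ c≋c′ realize u v w = record
    { character = character
    ; ev-a = trans (sym (ev-cong a≋a′)) ev-a
    ; ev-b = trans (sym (ev-cong b≋b′)) ev-b
    ; ev-c = trans (sym (ev-cong c≋c′)) ev-c
    ; markov = markov }
    where open Realization (realize u v w)

  realizable-swap₁₂ : ∀ {k l n a b c} → FreelyRealizable k l n a b c → FreelyRealizable l k n b a c
  realizable-swap₁₂ realize v u w = record
    { character = character ; ev-a = ev-b ; ev-b = ev-a ; ev-c = ev-c
    ; markov = ℚ-Forms.MarkovEquation-swap₁₂ markov }
    where open Realization (realize u v w)

  realizable-swap₂₃ : ∀ {k l n a b c} → FreelyRealizable k l n a b c → FreelyRealizable k n l a c b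
  realizable-swap₂₃ realize u w v = record
    { character = character ; ev-a = ev-a ; ev-b = ev-c ; ev-c = ev-b
    ; markov = ℚ-Forms.MarkovEquation-swap₂₃ markov }
    where open Realization (realize u v w)

  realizable-mutate : ∀ {k l n a a′ b c} → Laurent-Forms.ExchangeRelation (κ k) a a′ b c →
    FreelyRealizable k l n a b c → FreelyRealizable k l n a′ b c
  realizable-mutate {k} {a = a} {a′} {b} {c} exchange realize u v w = record
    { character = character
    ; ev-a = *-cancelˡ-pos u′ (trans (ℚ-Forms.relation u′*ev-a′≡N) (sym (÷-*-cancel N u)))
    ; ev-b = ev-b
    ; ev-c = ev-c
    ; markov = ℚ-Forms.vieta (*-cancelˡ-pos u′) (ℚ-Forms.related (÷-*-cancel N u)) markov }
    where
    N : ℚ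
    N = ℚ-Forms.exchangeForm (natural k) v w
    instance
      u≢0 : ℚ.NonZero u
      u≢0 = ℚ.pos⇒nonZero u
    u′ : ℚ
    u′ = N ℚ.÷ u
    instance
      u′>0 : Positive u′
      u′>0 = ℚ.pos*pos⇒pos N {{exchangeForm-positive k v w}} (ℚ.1/ u) {{ℚ.1/pos⇒pos u}}
    open Realization (realize u′ v w)
    open FormHomomorphisms laurentRing ℚ.+-*-commutativeRing ev-isRingHomomorphism
    u′*ev-a′≡N : ℚ-Forms.ExchangeRelation (natural k) u′ (ev a′) v w
    u′*ev-a′≡N = ExchangeRelation-homo (ev-cst (+ k)) ev-a refl ev-b ev-c exchange

  realizable⇒middle-parity : ∀ {k l n k′ l′ n′ a b c} → FreelyRealizable k l n a b c →
    Laurent-Forms.MarkovEquation M (κ k′) (κ l′) (κ n′) a b c → l ≡ l′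
  realizable⇒middle-parity {k} {l} {n} {k′} {l′} {n′} {a} {b} {c} realize markov′ =
    ℤ.+-injective (fromℤ-injective (begin
      natural l                                  ≡⟨ ℚ-Forms.middle-coefficient (natural k) (natural l) (natural n) ⟨
      2ℚ ℚ.* form 1ℚ 1ℚ 1ℚ ℚ.- form 1ℚ 2ℚ 1ℚ     ≡⟨ cong₂ (λ x y → 2ℚ ℚ.* x ℚ.- y) (agree 1ℚ 1ℚ 1ℚ) (agree 1ℚ 2ℚ 1ℚ) ⟩
      2ℚ ℚ.* form′ 1ℚ 1ℚ 1ℚ ℚ.- form′ 1ℚ 2ℚ 1ℚ   ≡⟨ ℚ-Forms.middle-coefficient (natural k′) (natural l′) (natural n′) ⟩
      natural l′                                 ∎))
    where
    open ≡-Reasoning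
    2ℚ : ℚ
    2ℚ = 1ℚ ℚ.+ 1ℚ
    form form′ : ℚ → ℚ → ℚ → ℚ
    form  = ℚ-Forms.markovForm (natural k) (natural l) (natural n)
    form′ = ℚ-Forms.markovForm (natural k′) (natural l′) (natural n′)
    agree : ∀ u v w .{{_ : Positive u}} .{{_ : Positive v}} .{{_ : Positive w}} → form u v w ≡ form′ u v w
    agree u v w = trans (sym (ℚ-Forms.equation markov))
      (ℚ-Forms.equation (MarkovEquation-homo (ev-cst (+ k′)) (ev-cst (+ l′)) (ev-cst (+ n′)) ev-a ev-b ev-c markov′))
      where
      open Realization (realize u v w)
      open FormHomomorphisms laurentRing ℚ.+-*-commutativeRing ev-isRingHomomorphism

module Evaluation (u v w : ℚ) .{{_ : ℚ.NonZero u}} .{{_ : ℚ.NonZero v}} .{{_ : ℚ.NonZero w}} where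

  open IntegerMultiples ℚ.*-1-commutativeMonoid using (module Multiples)
  open Multiples u (ℚ.1/ u) (ℚ.*-inverseʳ u)
    using () renaming (multiple to u^_; multiple-+ to u^-+)
  open Multiples v (ℚ.1/ v) (ℚ.*-inverseʳ v)
    using () renaming (multiple to v^_; multiple-+ to v^-+)
  open Multiples w (ℚ.1/ w) (ℚ.*-inverseʳ w)
    using () renaming (multiple to w^_; multiple-+ to w^-+)
  open ≡-Reasoning
  open +-*-Solver

  evaluation : Character
  evaluation = record
    { χ = λ (mono i j l) → u^ i ℚ.* v^ j ℚ.* w^ l
    ; χ-one = refl
    ; χ-monoMul = λ (mono i j l) (mono i′ j′ l′) → begin
        u^ (i ℤ.+ i′) ℚ.* v^ (j ℤ.+ j′) ℚ.* w^ (l ℤ.+ l′)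
          ≡⟨ cong₂ ℚ._*_ (cong₂ ℚ._*_ (u^-+ i i′) (v^-+ j j′)) (w^-+ l l′) ⟩
        (u^ i ℚ.* u^ i′) ℚ.* (v^ j ℚ.* v^ j′) ℚ.* (w^ l ℚ.* w^ l′)
          ≡⟨ solve 6 (λ x x′ y y′ z z′ → (x :* x′) :* (y :* y′) :* (z :* z′) := (x :* y :* z) :* (x′ :* y′ :* z′))
               refl (u^ i) (u^ i′) (v^ j) (v^ j′) (w^ l) (w^ l′) ⟩
        (u^ i ℚ.* v^ j ℚ.* w^ l) ℚ.* (u^ i′ ℚ.* v^ j′ ℚ.* w^ l′) ∎ }

  open Character evaluation

  ev-x₁ : ev x₁ ≡ u
  ev-x₁ = solve 1 (λ u → con 1ℚ :* (u :* con 1ℚ :* con 1ℚ) :+ con 0ℚ := u) refl u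

  ev-x₂ : ev x₂ ≡ v
  ev-x₂ = solve 1 (λ v → con 1ℚ :* (con 1ℚ :* v :* con 1ℚ) :+ con 0ℚ := v) refl v

  ev-x₃ : ev x₃ ≡ w
  ev-x₃ = solve 1 (λ w → con 1ℚ :* (con 1ℚ :* con 1ℚ :* w) :+ con 0ℚ := w) refl w

-- Clusters

module Clusters (k₁ k₂ k₃ : ℕ) where

  open Realizations (𝓜 k₁ k₂ k₃)
  open Laurent-Forms using (MarkovEquation; satisfied; markovForm; ExchangeRelation; related; relation;
    ExchangeRelation-cong; ExchangeRelation-comm)

  initial-markov : MarkovEquation (𝓜 k₁ k₂ k₃) (κ k₁) (κ k₂) (κ k₃) x₁ x₂ x₃
  initial-markov = satisfied (≋.trans (*-assoc numerator x123⁻¹ (x₁ * x₂ * x₃))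
    (≋.trans (*-comm numerator (cst (+ 1))) (*-identityˡ numerator)))
    where
    numerator : Laurent
    numerator = markovForm (κ k₁) (κ k₂) (κ k₃) x₁ x₂ x₃

  initial-realizable : FreelyRealizable k₁ k₂ k₃ x₁ x₂ x₃
  initial-realizable u v w = record
    { character = evaluation ; ev-a = ev-x₁ ; ev-b = ev-x₂ ; ev-c = ev-x₃
    ; markov = MarkovEquation-homo (ev-cst (+ k₁)) (ev-cst (+ k₂)) (ev-cst (+ k₃)) ev-x₁ ev-x₂ ev-x₃ initial-markov }
    where
    open Evaluation u v w {{ℚ.pos⇒nonZero u}} {{ℚ.pos⇒nonZero v}} {{ℚ.pos⇒nonZero w}}
    open Character evaluation
    open FormHomomorphisms laurentRing ℚ.+-*-commutativeRing ev-isRingHomomorphism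

  labeled-realizable : ∀ {a b c} → Labeled k₁ k₂ k₃ a b c → FreelyRealizable k₁ k₂ k₃ a b c
  labeled-realizable (base a≈ b≈ c≈) =
    realizable-resp (≋.sym (≈⇒≋ a≈)) (≋.sym (≈⇒≋ b≈)) (≋.sym (≈⇒≋ c≈)) initial-realizable
  labeled-realizable (mut₁ L aa′≈) = realizable-mutate (related (≈⇒≋ aa′≈)) (labeled-realizable L)
  labeled-realizable (mut₂ L bb′≈) =
    realizable-swap₁₂ (realizable-mutate (related (≈⇒≋ bb′≈)) (realizable-swap₁₂ (labeled-realizable L)))
  labeled-realizable (mut₃ L cc′≈) =
    realizable-swap₂₃ (realizable-swap₁₂ (realizable-mutate (related (≈⇒≋ cc′≈))
      (realizable-swap₁₂ (realizable-swap₂₃ (labeled-realizable L)))))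

  mutate₁ : ∀ {a a′ b c} → Labeled k₁ k₂ k₃ a b c → ExchangeRelation (κ k₁) a a′ b c → Labeled k₁ k₂ k₃ a′ b c
  mutate₁ L exchange = mut₁ L (≋⇒≈ (relation exchange))

  mutate₂ : ∀ {a b b′ c} → Labeled k₁ k₂ k₃ a b c → ExchangeRelation (κ k₂) b b′ a c → Labeled k₁ k₂ k₃ a b′ c
  mutate₂ L exchange = mut₂ L (≋⇒≈ (relation exchange))

  mutate₃ : ∀ {a b c c′} → Labeled k₁ k₂ k₃ a b c → ExchangeRelation (κ k₃) c c′ a b → Labeled k₁ k₂ k₃ a b c′
  mutate₃ L exchange = mut₃ L (≋⇒≈ (relation exchange))

  Labeled-resp : ∀ {a b c a′ b′ c′} → a ≋ a′ → b ≋ b′ → c ≋ c′ →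
    Labeled k₁ k₂ k₃ a b c → Labeled k₁ k₂ k₃ a′ b′ c′
  Labeled-resp p q r (base a≈ b≈ c≈) = base (transport x₁ p a≈) (transport x₂ q b≈) (transport x₃ r c≈)
    where
    transport : ∀ x {a a′} → a ≋ a′ → a ≈ x → a′ ≈ x
    transport x a≋a′ a≈x = ≋⇒≈ (≋.trans (≋.sym a≋a′) (≈⇒≋ {q = x} a≈x))
  Labeled-resp p q r (mut₁ L aa′≈) = mutate₁ (Labeled-resp ≋.refl q r L)
    (ExchangeRelation-cong ≋.refl ≋.refl p q r (related (≈⇒≋ aa′≈)))
  Labeled-resp p q r (mut₂ L bb′≈) = mutate₂ (Labeled-resp p ≋.refl r L)
    (ExchangeRelation-cong ≋.refl ≋.refl q p r (related (≈⇒≋ bb′≈)))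
  Labeled-resp p q r (mut₃ L cc′≈) = mutate₃ (Labeled-resp p q ≋.refl L)
    (ExchangeRelation-cong ≋.refl ≋.refl r p q (related (≈⇒≋ cc′≈)))

  fromLabeled : ∀ {a b c} → Labeled k₁ k₂ k₃ a b c → LabeledCluster k₁ k₂ k₃ a b c
  fromLabeled L = _ , _ , _ , L , (λ m → refl) , (λ m → refl) , (λ m → refl)

  toLabeled : ∀ {a b c} → LabeledCluster k₁ k₂ k₃ a b c → Labeled k₁ k₂ k₃ a b c
  toLabeled (_ , _ , _ , L , a≈ , b≈ , c≈) = Labeled-resp (≋.sym (≈⇒≋ a≈)) (≋.sym (≈⇒≋ b≈)) (≋.sym (≈⇒≋ c≈)) L

  NonLabeledCluster-resp : ∀ {a b c a′ b′ c′} → a ≋ a′ → b ≋ b′ → c ≋ c′ →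
    NonLabeledCluster k₁ k₂ k₃ a b c → NonLabeledCluster k₁ k₂ k₃ a′ b′ c′
  NonLabeledCluster-resp p q r =
    Sum.map (resp p q r) (Sum.map (resp p r q) (Sum.map (resp q p r)
      (Sum.map (resp q r p) (Sum.map (resp r p q) (resp r q p)))))
    where
    resp : ∀ {a b c a′ b′ c′} → a ≋ a′ → b ≋ b′ → c ≋ c′ →
      LabeledCluster k₁ k₂ k₃ a b c → LabeledCluster k₁ k₂ k₃ a′ b′ c′
    resp p q r C = fromLabeled (Labeled-resp p q r (toLabeled C))

  Parity-resp : ∀ {y z k} → y ≋ z → Parity k₁ k₂ k₃ y k → Parity k₁ k₂ k₃ z k
  Parity-resp y≋z (pos₁ L y≈a) = pos₁ (Labeled-resp (≋.trans (≋.sym (≈⇒≋ y≈a)) y≋z) ≋.refl ≋.refl L) (λ m → refl)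
  Parity-resp y≋z (pos₂ L y≈b) = pos₂ (Labeled-resp ≋.refl (≋.trans (≋.sym (≈⇒≋ y≈b)) y≋z) ≋.refl L) (λ m → refl)
  Parity-resp y≋z (pos₃ L y≈c) = pos₃ (Labeled-resp ≋.refl ≋.refl (≋.trans (≋.sym (≈⇒≋ y≈c)) y≋z) L) (λ m → refl)

  MiddleMutable : (a b c : Laurent) (l : ℕ) → Set
  MiddleMutable a b c l =
    ∀ y → ExchangeRelation (κ l) b y a c → NonLabeledCluster k₁ k₂ k₃ a y c × Parity k₁ k₂ k₃ y l

  nonLabeled-mutable : ∀ {a b c} → NonLabeledCluster k₁ k₂ k₃ a b c →
    ∃[ k ] ∃[ l ] ∃[ n ] (FreelyRealizable k l n a b c × MiddleMutable a b c l)
  nonLabeled-mutable = λ where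
      (inj₁ abc) → let L = toLabeled abc in
        _ , _ , _ , labeled-realizable L ,
        λ y exchange → let L′ = mutate₂ L exchange in inj₁ (fromLabeled L′) , pos₂ L′ (λ m → refl)
      (inj₂ (inj₁ acb)) → let L = toLabeled acb in
        _ , _ , _ , realizable-swap₂₃ (labeled-realizable L) ,
        λ y exchange → let L′ = mutate₃ L exchange in inj₂ (inj₁ (fromLabeled L′)) , pos₃ L′ (λ m → refl)
      (inj₂ (inj₂ (inj₁ bac))) → let L = toLabeled bac in
        _ , _ , _ , realizable-swap₁₂ (labeled-realizable L) ,
        λ y exchange → let L′ = mutate₁ L exchange in inj₂ (inj₂ (inj₁ (fromLabeled L′))) , pos₁ L′ (λ m → refl)
      (inj₂ (inj₂ (inj₂ (inj₁ bca)))) → let L = toLabeled bca in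
        _ , _ , _ , realizable-swap₁₂ (realizable-swap₂₃ (labeled-realizable L)) ,
        λ y exchange → let L′ = mutate₁ L (ExchangeRelation-comm exchange) in
          inj₂ (inj₂ (inj₂ (inj₁ (fromLabeled L′)))) , pos₁ L′ (λ m → refl)
      (inj₂ (inj₂ (inj₂ (inj₂ (inj₁ cab))))) → let L = toLabeled cab in
        _ , _ , _ , realizable-swap₂₃ (realizable-swap₁₂ (labeled-realizable L)) ,
        λ y exchange → let L′ = mutate₃ L (ExchangeRelation-comm exchange) in
          inj₂ (inj₂ (inj₂ (inj₂ (inj₁ (fromLabeled L′))))) , pos₃ L′ (λ m → refl)
      (inj₂ (inj₂ (inj₂ (inj₂ (inj₂ cba))))) → let L = toLabeled cba in
        _ , _ , _ , realizable-swap₁₂ (realizable-swap₂₃ (realizable-swap₁₂ (labeled-realizable L))) ,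
        λ y exchange → let L′ = mutate₂ L (ExchangeRelation-comm exchange) in
          inj₂ (inj₂ (inj₂ (inj₂ (inj₂ (fromLabeled L′))))) , pos₂ L′ (λ m → refl)

  mutate-middle : ∀ {k l n a b c} → NonLabeledCluster k₁ k₂ k₃ a b c →
    MarkovEquation (𝓜 k₁ k₂ k₃) (κ k) (κ l) (κ n) a b c → MiddleMutable a b c l
  mutate-middle {a = a} {b} {c} cluster equation = let
      _ , _ , _ , realizable , mutable = nonLabeled-mutable cluster
    in subst (MiddleMutable a b c) (realizable⇒middle-parity realizable equation) mutable

-- The decomposition of a CGC triple

open SpecialLinear laurentRing using (SL₂; _because_; ⌊_⌋; unimodular; SL₂-group; _≈₂_) renaming (tr to trace)
open Group SL₂-group using (_∙_)

toSL₂ : ∀ A → InSL2 A → SL₂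
toSL₂ A detA = matrix (m₁₁ A) (m₁₂ A) (m₂₁ A) (m₂₂ A) because ≈⇒≋ detA

fromMatrix : Matrix Laurent → Mat
fromMatrix (matrix a b c d) = mat a b c d

toMatrix : Mat → Matrix Laurent
toMatrix (mat a b c d) = matrix a b c d

≈M⇒≈₂ : ∀ A B → A ≈M B → toMatrix A ≈₂ toMatrix B
≈M⇒≈₂ A B (p , q , r , s) = ≈⇒≋ p , ≈⇒≋ q , ≈⇒≋ r , ≈⇒≋ s

≈₂⇒≈M : ∀ A B → A ≈₂ B → fromMatrix A ≈M fromMatrix B
≈₂⇒≈M A B (p , q , r , s) = ≋⇒≈ p , ≋⇒≈ q , ≋⇒≈ r , ≋⇒≈ s

module MarkovMonodromy (k₁ k₂ k₃ : ℕ) where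

  open Clusters k₁ k₂ k₃ using (NonLabeledCluster-resp; Parity-resp; mutate-middle)
  open Monodromy laurentRing (𝓜 k₁ k₂ k₃) using (T-SL₂; module Decomposition) renaming (module CGCTriple to CGC)

  firstFactor lastFactor : Mat → Mat
  firstFactor P = T k₁ k₂ k₃ · negM P
  lastFactor R = negM R · T k₁ k₂ k₃

  middleFactor : Mat → Mat → Mat
  middleFactor P R = inv (firstFactor P) · (T k₁ k₂ k₃ · inv (lastFactor R))

  decomposition : ∀ P Q R a b c → CGCTriple k₁ k₂ k₃ P Q R a b c →
    MMDecomposition k₁ k₂ k₃ P Q R a b c (firstFactor P) (middleFactor P R) (lastFactor R)
  decomposition P Q R a b c
    ((detP , k , parityP , trP) , (detQ , l , parityQ , trQ) , (detR , n , parityR , trR) ,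
     Q≈PR⊖S , p≈a , q≈b , r≈c , cluster) =
      ( cmmMatrix X (Parity-resp p≋x parityP) trX≈-k
      , cmmMatrix Y (proj₂ mutated) trY≈-l
      , cmmMatrix Z (Parity-resp r≋z parityR) trZ≈-n
      , ≈₂⇒≈M ⌊ (X ∙ Y) ∙ Z ⌋ ⌊ T-SL₂ ⌋ XYZ≈T
      , proj₁ mutated )
    , ≈₂⇒≈M ⌊ P′ ⌋ _ P≈-[YZ]⁻¹ , ≈₂⇒≈M ⌊ Q′ ⌋ _ Q≈-[XZ]⁻¹ , ≈₂⇒≈M ⌊ R′ ⌋ _ R≈-[XY]⁻¹
    , (k , Parity-resp (≈⇒≋ p≈a) parityP , ≋⇒≈ trX≈-k)
    , (l , Parity-resp (≈⇒≋ q≈b) parityQ , ≋⇒≈ trY≈-l)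
    , (n , Parity-resp (≈⇒≋ r≈c) parityR , ≋⇒≈ trZ≈-n)
    where
    P′ Q′ R′ : SL₂
    P′ = toSL₂ P detP
    Q′ = toSL₂ Q detQ
    R′ = toSL₂ R detR

    open Decomposition P′ R′
    open CGC P′ Q′ R′ (≈M⇒≈₂ Q (P · R ⊖ S k₁ k₂ k₃ Q) Q≈PR⊖S)
    open Traces (≈⇒≋ trP) (≈⇒≋ trQ) (≈⇒≋ trR)

    p≋x : m₁₂ P ≋ e₁₂ ⌊ X ⌋
    p≋x = ≋.sym e₁₂[X]≈e₁₂[P]

    r≋z : m₁₂ R ≋ e₁₂ ⌊ Z ⌋
    r≋z = ≋.sym e₁₂[Z]≈e₁₂[R]

    cluster-XQZ : NonLabeledCluster k₁ k₂ k₃ (e₁₂ ⌊ X ⌋) (m₁₂ Q) (e₁₂ ⌊ Z ⌋)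
    cluster-XQZ = NonLabeledCluster-resp {a} {b} {c} {b′ = m₁₂ Q}
      (≋.trans (≋.sym (≈⇒≋ p≈a)) p≋x) (≋.sym (≈⇒≋ q≈b)) (≋.trans (≋.sym (≈⇒≋ r≈c)) r≋z) cluster

    mutated : NonLabeledCluster k₁ k₂ k₃ (e₁₂ ⌊ X ⌋) (e₁₂ ⌊ Y ⌋) (e₁₂ ⌊ Z ⌋) × Parity k₁ k₂ k₃ (e₁₂ ⌊ Y ⌋) l
    mutated = mutate-middle cluster-XQZ markov-XQZ (e₁₂ ⌊ Y ⌋) exchange-QY

    cmmMatrix : ∀ X {k} → Parity k₁ k₂ k₃ (e₁₂ ⌊ X ⌋) k → trace ⌊ X ⌋ ≋ - κ k →
      CMMMatrix k₁ k₂ k₃ (fromMatrix ⌊ X ⌋)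
    cmmMatrix X {k} parity trX = ≋⇒≈ (unimodular X) , k , parity , ≋⇒≈ trX

  decomposition-unique : ∀ P Q R a b c → CGCTriple k₁ k₂ k₃ P Q R a b c →
    ∀ X Y Z → MMDecomposition k₁ k₂ k₃ P Q R a b c X Y Z →
    X ≈M firstFactor P × Y ≈M middleFactor P R × Z ≈M lastFactor R
  decomposition-unique P Q R a b c ((detP , _) , _ , (detR , _) , _)
    X Y Z (((detX , _) , (detY , _) , (detZ , _) , XYZ≈T , _) , P≈-[YZ]⁻¹ , _ , R≈-[XY]⁻¹ , _) = let
      X≈ , Y≈ , Z≈ = 𝓓.unique (toSL₂ X detX) (toSL₂ Y detY) (toSL₂ Z detZ)
        (≈M⇒≈₂ (X · Y · Z) (T k₁ k₂ k₃) XYZ≈T)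
        (≈M⇒≈₂ P (negM (inv (Y · Z))) P≈-[YZ]⁻¹) (≈M⇒≈₂ R (negM (inv (X · Y))) R≈-[XY]⁻¹)
    in ≈₂⇒≈M (toMatrix X) ⌊ 𝓓.X ⌋ X≈ , ≈₂⇒≈M (toMatrix Y) ⌊ 𝓓.Y ⌋ Y≈ , ≈₂⇒≈M (toMatrix Z) ⌊ 𝓓.Z ⌋ Z≈
    where module 𝓓 = Decomposition (toSL₂ P detP) (toSL₂ R detR)

theorem6p13 : (k₁ k₂ k₃ : ℕ) (P Q R : Mat) (a b c : Laurent) →
  CGCTriple k₁ k₂ k₃ P Q R a b c →
  (∣ a ∣ ⊔ ∣ c ∣) < ∣ b ∣ →
  Σ Mat (λ X → Σ Mat (λ Y → Σ Mat (λ Z →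
    MMDecomposition k₁ k₂ k₃ P Q R a b c X Y Z ×
    ((X' Y' Z' : Mat) → MMDecomposition k₁ k₂ k₃ P Q R a b c X' Y' Z' →
      X' ≈M X × Y' ≈M Y × Z' ≈M Z))))
theorem6p13 k₁ k₂ k₃ P Q R a b c cgc _ =
  firstFactor P , middleFactor P R , lastFactor R ,
  decomposition P Q R a b c cgc , decomposition-unique P Q R a b c cgc
  where open MarkovMonodromy k₁ k₂ k₃
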